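{- Let $\alpha,\lambda>0$ be real and, for all sufficiently large $n$, let $p=p_n=1-\frac{\lambda}{n^{\alpha}}$. Let $X_n$ be the number of correct guesses in the complete-feedback card guessing game after one asymmetric single-shelf shuffle with parameter $p_n$ of $n$ cards. Then, as $n\to\infty$, $$\mathbb P\{X_n=n\}\to\begin{cases}0,& 0<\alpha<1,\\ e^{ -\lambda},&\alpha=1,\\ 1,&\alpha>1.\end{cases}$$
   Context: Asymmetric single-shelf shuffle with parameter $p\in(0,1)$: an ordered deck of $n$ cards labelled $1,\dots,n$ (card $1$ on top, card $n$ at the bottom) is given. Cards are drawn one by one from the bottom of the deck (so in the order $n,n-1,\dots,1$) and put on an initially empty pile; each drawn card is placed, independently, at the top of the pile with probability $p$ and at the bottom of the pile with probability $1-p$. The final pile is the shuffled deck. Game: cards are drawn one after the other from the top of the shuffled deck. Before each draw the player guesses the label of the card; afterwards the card is shown (complete feedback). For $p\ge\frac12$ (which holds for $p=p_n$ when $n$ is large) the player uses the following optimal strategy: the first guess is card $1$; as long as neither card $n-1$ nor card $n$ has been shown, the next guess is the label immediately following that of the most recently shown card; once one of the cards $n-1$ or $n$ has been shown, the player guesses the remaining (not yet shown) cards in descending order. $X_n$ denotes the total number of correct guesses. -}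

module Defs where

open import Data.Bool using (if_then_else_; _∨_)
open import Data.Fin using (toℕ)
open import Data.Integer using (+_)
import Data.Integer as ℤ
import Data.Integer.Properties as ℤP
open import Data.List using (List; []; _∷_; _∷ʳ_; _++_; filter; map; foldr; upTo)
open import Data.List.Membership.DecPropositional using (_∈?_; _∉?_)
open import Data.List.Extrema.Nat using (max)
open import Data.Nat using (ℕ; zero; suc; _∸_; _≥_)
import Data.Nat as ℕ
import Data.Nat.Properties as ℕP
import Data.Nat.Tactic.RingSolver as ℕSolver
open import Data.Product using (∃-syntax; _×_; _,_; proj₁; proj₂)
open import Data.Rational
  using (ℚ; 0ℚ; 1ℚ; ½; _/_; _+_; _*_; -_; _-_; 1/_; ∣_∣; _≤_; _<_; toℚᵘ; mkℚ;
         positive; nonNegative)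
open import Data.Rational.Properties
import Data.Rational.Unnormalised as ℚᵘ
import Data.Rational.Unnormalised.Properties as ℚᵘP
open import Data.Rational.Solver using (module +-*-Solver)
open import Data.Sum using (inj₁; inj₂)
open import Data.Vec using (Vec; []; _∷_; tabulate; zip)
import Data.Vec as Vec
open import Function using (_∘_)
open import Relation.Binary.PropositionalEquality
open import Relation.Nullary using (does)
open import Relation.Unary using (Pred; Decidable)
open import Level using (0ℓ)

open +-*-Solver using (solve; _:+_; _:*_; :-_; _:-_; con; _:=_)

------------------------------------------------------------------------
-- Auxiliary facts about ℚ

neg-sub : ∀ p q → - (p - q) ≡ q - p
neg-sub = solve 2 (λ p q → :- (p :- q) := q :- p) refl

split-sub : ∀ p q r → (p - q) + (q - r) ≡ p - r
split-sub = solve 3 (λ p q r → (p :- q) :+ (q :- r) := p :- r) refl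

sub-add : ∀ p q → (p - q) + q ≡ p
sub-add = solve 2 (λ p q → (p :- q) :+ q := p) refl

add-sub : ∀ r q → r + q - q ≡ r
add-sub = solve 2 (λ r q → r :+ q :- q := r) refl

halves : ∀ ε → ε * ½ + ε * ½ ≡ ε
halves = solve 1 (λ ε → ε :* con ½ :+ ε :* con ½ := ε) refl

move-inv : ∀ C e i → C * (e * i) ≡ e * (C * i)
move-inv = solve 3 (λ C e i → C :* (e :* i) := e :* (C :* i)) refl

neg-neg-sub : ∀ a b → b - a ≡ - a - - b
neg-neg-sub = solve 2 (λ a b → b :- a := :- a :- :- b) refl

interchange : ∀ a b c d → (a + b) - (c + d) ≡ (a - c) + (b - d)
interchange = solve 4 (λ a b c d → (a :+ b) :- (c :+ d) := (a :- c) :+ (b :- d)) refl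

double : ∀ ε → ε + ε ≡ (1ℚ + 1ℚ) * ε
double = solve 1 (λ ε → ε :+ ε := (con 1ℚ :+ con 1ℚ) :* ε) refl

product-sub : ∀ a b c d → a * b - c * d ≡ a * (b - d) + (a - c) * d
product-sub = solve 4 (λ a b c d → a :* b :- c :* d := a :* (b :- d) :+ (a :- c) :* d) refl

product-bound : ∀ K L ε → K * ε + ε * L ≡ (K + L) * ε
product-bound = solve 3 (λ K L ε → K :* ε :+ ε :* L := (K :+ L) :* ε) refl

rotate : ∀ u r i → u * r * i ≡ u * (i * r)
rotate = solve 3 (λ u r i → u :* r :* i := u :* (i :* r)) refl

one-term : ∀ a b → 1ℚ * a * 1ℚ - 1ℚ * b * 1ℚ ≡ a - b
one-term = solve 2 (λ a b → con 1ℚ :* a :* con 1ℚ :- con 1ℚ :* b :* con 1ℚ := a :- b) refl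

term-sub : ∀ u v a b r → u * a * r - v * b * r ≡ ((u - v) * a + v * (a - b)) * r
term-sub = solve 5 (λ u v a b r → u :* a :* r :- v :* b :* r := ((u :- v) :* a :+ v :* (a :- b)) :* r) refl

swap-mid : ∀ t d K e → t * d * K + e ≡ t * K * d + e
swap-mid = solve 4 (λ t d K e → t :* d :* K :+ e := t :* K :* d :+ e) refl

collect : ∀ s i d → s * i * d + s * d ≡ s * d * (i + 1ℚ)
collect = solve 3 (λ s i d → s :* i :* d :+ s :* d := s :* d :* (i :+ con 1ℚ)) refl

add-sub-comm : ∀ p u q → (p + u) - q ≡ (p - q) + u
add-sub-comm = solve 3 (λ p u q → (p :+ u) :- q := (p :- q) :+ u) refl

double-term : ∀ t K r → t * K * r + t * K * r ≡ t * ((K + K) * r)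
double-term = solve 3 (λ t K r → t :* K :* r :+ t :* K :* r := t :* ((K :+ K) :* r)) refl

swap-front : ∀ i ε r → i * (ε * r) ≡ ε * (i * r)
swap-front = solve 3 (λ i ε r → i :* (ε :* r) := ε :* (i :* r)) refl

exp-bound : ∀ ε D → (ε + ε) + D * ε ≡ (D + (1ℚ + 1ℚ)) * ε
exp-bound = solve 2 (λ ε D → (ε :+ ε) :+ D :* ε := (D :+ (con 1ℚ :+ con 1ℚ)) :* ε) refl

suc-mult : ∀ i b → i * b + b ≡ (i + 1ℚ) * b
suc-mult = solve 2 (λ i b → i :* b :+ b := (i :+ con 1ℚ) :* b) refl

insert : ∀ h r s → s + r ≡ (h + r + s) - h
insert = solve 3 (λ h r s → s :+ r := (h :+ r :+ s) :- h) refl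

remove : ∀ h r b → (h + r + b) - h ≡ r + b
remove = solve 3 (λ h r b → (h :+ r :+ b) :- h := r :+ b) refl

ι : ℕ → ℚ
ι n = + n / 1

recip : ℕ → ℚ
recip k = + 1 / suc k

ι-suc : ∀ n → ι (suc n) ≡ ι n + 1ℚ
ι-suc n = toℚᵘ-injective (begin
  toℚᵘ (ι (suc n))                    ≈⟨ toℚᵘ-fromℚᵘ (ℚᵘ.mkℚᵘ (+ suc n) 0) ⟩
  ℚᵘ.mkℚᵘ (+ suc n) 0                 ≈⟨ ℚᵘ.*≡* (cong (ℤ._* + 1) (lem n)) ⟩
  ℚᵘ.mkℚᵘ (+ n) 0 ℚᵘ.+ toℚᵘ 1ℚ        ≈⟨ ℚᵘP.+-congˡ (toℚᵘ 1ℚ) (toℚᵘ-fromℚᵘ (ℚᵘ.mkℚᵘ (+ n) 0)) ⟨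
  toℚᵘ (ι n) ℚᵘ.+ toℚᵘ 1ℚ             ≈⟨ toℚᵘ-homo-+ (ι n) 1ℚ ⟨
  toℚᵘ (ι n + 1ℚ)                     ∎)
  where
  open ℚᵘP.≃-Reasoning
  lem : ∀ n → + suc n ≡ + n ℤ.* + 1 ℤ.+ + 1
  lem n = trans (cong +_ (sym (ℕP.+-comm n 1))) (cong (ℤ._+ + 1) (sym (ℤP.*-identityʳ (+ n))))

recip-inverseʳ : ∀ k → ι (suc k) * recip k ≡ 1ℚ
recip-inverseʳ k = toℚᵘ-injective (begin
  toℚᵘ (ι (suc k) * recip k)                    ≈⟨ toℚᵘ-homo-* (ι (suc k)) (recip k) ⟩
  toℚᵘ (ι (suc k)) ℚᵘ.* toℚᵘ (recip k)          ≈⟨ ℚᵘP.*-cong (toℚᵘ-fromℚᵘ (ℚᵘ.mkℚᵘ (+ suc k) 0)) (toℚᵘ-fromℚᵘ (ℚᵘ.mkℚᵘ (+ 1) k)) ⟩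
  ℚᵘ.mkℚᵘ (+ suc k) 0 ℚᵘ.* ℚᵘ.mkℚᵘ (+ 1) k      ≈⟨ ℚᵘP.*-inverseʳ (ℚᵘ.mkℚᵘ (+ suc k) 0) ⟩
  toℚᵘ 1ℚ                                       ∎)
  where open ℚᵘP.≃-Reasoning

ι-mono : ∀ {m n} → m ℕ.≤ n → ι m ≤ ι n
ι-mono {m} {n} m≤n = toℚᵘ-cancel-≤ (begin
  toℚᵘ (ι m)       ≃⟨ toℚᵘ-fromℚᵘ (ℚᵘ.mkℚᵘ (+ m) 0) ⟩
  ℚᵘ.mkℚᵘ (+ m) 0  ≤⟨ ℚᵘ.*≤* (ℤP.*-monoʳ-≤-nonNeg (+ 1) (ℤ.+≤+ m≤n)) ⟩
  ℚᵘ.mkℚᵘ (+ n) 0  ≃⟨ toℚᵘ-fromℚᵘ (ℚᵘ.mkℚᵘ (+ n) 0) ⟨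
  toℚᵘ (ι n)       ∎)
  where open ℚᵘP.≤-Reasoning

recip-anti : ∀ {m n} → m ℕ.≤ n → recip n ≤ recip m
recip-anti {m} {n} m≤n = toℚᵘ-cancel-≤ (begin
  toℚᵘ (recip n)   ≃⟨ toℚᵘ-fromℚᵘ (ℚᵘ.mkℚᵘ (+ 1) n) ⟩
  ℚᵘ.mkℚᵘ (+ 1) n  ≤⟨ ℚᵘ.*≤* (ℤP.*-monoˡ-≤-nonNeg (+ 1) (ℤ.+≤+ (ℕ.s≤s m≤n))) ⟩
  ℚᵘ.mkℚᵘ (+ 1) m  ≃⟨ toℚᵘ-fromℚᵘ (ℚᵘ.mkℚᵘ (+ 1) m) ⟨
  toℚᵘ (recip m)   ∎)
  where open ℚᵘP.≤-Reasoning

0<recip : ∀ k → 0ℚ < recip k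
0<recip k = positive⁻¹ (recip k) {{normalize-pos 1 (suc k)}}

0≤recip : ∀ k → 0ℚ ≤ recip k
0≤recip k = <⇒≤ (0<recip k)

archimedean : ∀ q → ∃[ n ] q ≤ ι n
archimedean q@(mkℚ a d _) = ℤ.∣ a ∣ , toℚᵘ-cancel-≤ (begin
  toℚᵘ q                   ≤⟨ ℚᵘ.*≤* lem ⟩
  ℚᵘ.mkℚᵘ (+ ℤ.∣ a ∣) 0    ≃⟨ toℚᵘ-fromℚᵘ (ℚᵘ.mkℚᵘ (+ ℤ.∣ a ∣) 0) ⟨
  toℚᵘ (ι ℤ.∣ a ∣)         ∎)
  where
  open ℚᵘP.≤-Reasoning
  i≤∣i∣ : ∀ i → i ℤ.≤ + ℤ.∣ i ∣
  i≤∣i∣ (+ n)       = ℤP.≤-refl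
  i≤∣i∣ ℤ.-[1+ n ]  = ℤ.-≤+
  lem : a ℤ.* + 1 ℤ.≤ + ℤ.∣ a ∣ ℤ.* + suc d
  lem = ℤP.≤-trans (ℤP.*-monoʳ-≤-nonNeg (+ 1) (i≤∣i∣ a))
                   (ℤP.*-monoˡ-≤-nonNeg (+ ℤ.∣ a ∣) (ℤ.+≤+ (ℕ.s≤s ℕ.z≤n)))

*-mono-≤₀ : ∀ {a b c d} → 0ℚ ≤ b → 0ℚ ≤ c → a ≤ b → c ≤ d → a * c ≤ b * d
*-mono-≤₀ {a} {b} {c} {d} 0≤b 0≤c a≤b c≤d = ≤-trans
  (*-monoʳ-≤-nonNeg c {{nonNegative 0≤c}} a≤b)
  (*-monoˡ-≤-nonNeg b {{nonNegative 0≤b}} c≤d)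

0≤* : ∀ {a b} → 0ℚ ≤ a → 0ℚ ≤ b → 0ℚ ≤ a * b
0≤* {a} {b} 0≤a 0≤b = subst (_≤ a * b) (*-zeroʳ a) (*-monoˡ-≤-nonNeg a {{nonNegative 0≤a}} 0≤b)

0<* : ∀ {a b} → 0ℚ < a → 0ℚ < b → 0ℚ < a * b
0<* {a} {b} 0<a 0<b = subst (_< a * b) (*-zeroʳ a) (*-monoʳ-<-pos a {{positive 0<a}} 0<b)

0≤+ : ∀ {a b} → 0ℚ ≤ a → 0ℚ ≤ b → 0ℚ ≤ a + b
0≤+ 0≤a 0≤b = +-mono-≤ 0≤a 0≤b

recip-small : ∀ {ε} → 0ℚ < ε → ∃[ k ] recip k ≤ ε
recip-small {ε} 0<ε = k , (begin
  recip k                ≡⟨ *-identityˡ (recip k) ⟨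
  1ℚ * recip k           ≡⟨ cong (_* recip k) (*-inverseʳ ε) ⟨
  ε * i * recip k        ≤⟨ *-monoʳ-≤-nonNeg (recip k) {{nonNegative (0≤recip k)}}
                              (*-monoˡ-≤-nonNeg ε {{nonNegative (<⇒≤ 0<ε)}}
                                (≤-trans (proj₂ (archimedean i)) (ι-mono (ℕP.n≤1+n k)))) ⟩
  ε * ι (suc k) * recip k    ≡⟨ *-assoc ε (ι (suc k)) (recip k) ⟩
  ε * (ι (suc k) * recip k)  ≡⟨ cong (ε *_) (recip-inverseʳ k) ⟩
  ε * 1ℚ                 ≡⟨ *-identityʳ ε ⟩
  ε                      ∎)
  where
  open ≤-Reasoning
  instance
    _ = pos⇒nonZero ε {{positive 0<ε}}
  i = 1/ ε
  k = proj₁ (archimedean i)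

∣-∣-sym : ∀ p q → ∣ p - q ∣ ≡ ∣ q - p ∣
∣-∣-sym p q = trans (sym (∣-p∣≡∣p∣ (p - q)))
  (cong ∣_∣ (neg-sub p q))

∣-∣-triangle : ∀ p q r → ∣ p - r ∣ ≤ ∣ p - q ∣ + ∣ q - r ∣
∣-∣-triangle p q r = subst (λ z → ∣ z ∣ ≤ ∣ p - q ∣ + ∣ q - r ∣)
  (split-sub p q r)
  (∣p+q∣≤∣p∣+∣q∣ (p - q) (q - r))

∣p∣≤∣p-q∣+∣q∣ : ∀ p q → ∣ p ∣ ≤ ∣ p - q ∣ + ∣ q ∣
∣p∣≤∣p-q∣+∣q∣ p q = subst (λ z → ∣ z ∣ ≤ ∣ p - q ∣ + ∣ q ∣)
  (sub-add p q) (∣p+q∣≤∣p∣+∣q∣ (p - q) q)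

≤+⇒-≤ : ∀ {p q r} → p ≤ r + q → p - q ≤ r
≤+⇒-≤ {p} {q} {r} h = subst (p - q ≤_)
  (add-sub r q) (+-monoˡ-≤ (- q) h)

p≤q⇒0≤q-p : ∀ {p q} → p ≤ q → 0ℚ ≤ q - p
p≤q⇒0≤q-p {p} {q} h = subst (_≤ q - p) (+-inverseʳ p) (+-monoˡ-≤ (- p) h)

∣∣≤ : ∀ {p r} → p ≤ r → - p ≤ r → ∣ p ∣ ≤ r
∣∣≤ {p} {r} h₁ h₂ with ∣p∣≡p∨∣p∣≡-p p
... | inj₁ e = subst (_≤ r) (sym e) h₁
... | inj₂ e = subst (_≤ r) (sym e) h₂

∣∣p∣-∣q∣∣≤∣p-q∣ : ∀ p q → ∣ ∣ p ∣ - ∣ q ∣ ∣ ≤ ∣ p - q ∣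
∣∣p∣-∣q∣∣≤∣p-q∣ p q = ∣∣≤
  (≤+⇒-≤ (∣p∣≤∣p-q∣+∣q∣ p q))
  (subst₂ _≤_ (sym (neg-sub ∣ p ∣ ∣ q ∣)) (∣-∣-sym q p)
    (≤+⇒-≤ (∣p∣≤∣p-q∣+∣q∣ q p)))

½+½ : ∀ ε → ε * ½ + ε * ½ ≡ ε
½+½ ε = halves ε

0<ε½ : ∀ {ε} → 0ℚ < ε → 0ℚ < ε * ½
0<ε½ 0<ε = 0<* 0<ε (positive⁻¹ ½)

ε½<ε : ∀ {ε} → 0ℚ < ε → ε * ½ < ε
ε½<ε {ε} 0<ε = subst₂ _<_ (+-identityˡ (ε * ½)) (½+½ ε) (+-monoˡ-< (ε * ½) (0<ε½ 0<ε))

------------------------------------------------------------------------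
-- Real numbers: Cauchy sequences of rationals, with modulus, compared by _≈_

Cauchy : (ℕ → ℚ) → Set
Cauchy x = ∀ ε → 0ℚ < ε → ∃[ N ] ∀ m n → m ≥ N → n ≥ N → ∣ x m - x n ∣ < ε

record ℝ : Set where
  constructor mkℝ
  field
    seq    : ℕ → ℚ
    cauchy : Cauchy seq

open ℝ public

mkCauchy : ∀ {x} C → 0ℚ < C →
           (∀ ε → 0ℚ < ε → ∃[ N ] ∀ m n → n ≥ N → m ≥ n → ∣ x m - x n ∣ ≤ C * ε) →
           Cauchy x
mkCauchy {x} C 0<C h ε 0<ε = proj₁ hδ , λ m n m≥N n≥N → ≤-<-trans (bound m n m≥N n≥N) (ε½<ε 0<ε)
  where
  instance
    C>0 = positive 0<C
    C≢0 = pos⇒nonZero C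
  δ = ε * ½ * 1/ C
  hδ = h δ (0<* (0<ε½ 0<ε) (positive⁻¹ (1/ C) {{1/pos⇒pos C}}))
  Cδ : C * δ ≡ ε * ½
  Cδ = trans (move-inv C (ε * ½) (1/ C))
       (trans (cong (ε * ½ *_) (*-inverseʳ C)) (*-identityʳ _))
  bound : ∀ m n → m ≥ proj₁ hδ → n ≥ proj₁ hδ → ∣ x m - x n ∣ ≤ ε * ½
  bound m n m≥N n≥N with ℕP.≤-total n m
  ... | inj₁ n≤m = subst (_ ≤_) Cδ (proj₂ hδ m n n≥N n≤m)
  ... | inj₂ m≤n = subst₂ _≤_ (∣-∣-sym (x n) (x m)) Cδ (proj₂ hδ n m m≥N m≤n)

bounded : ∀ {x} → Cauchy x → ∃[ K ] 0ℚ < K × (∃[ N ] ∀ n → n ≥ N → ∣ x n ∣ ≤ K)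
bounded {x} c = let N , h = c 1ℚ (positive⁻¹ 1ℚ) in
  1ℚ + ∣ x N ∣ ,
  +-mono-<-≤ (positive⁻¹ 1ℚ) (0≤∣p∣ (x N)) ,
  N , λ n n≥N → ≤-trans (∣p∣≤∣p-q∣+∣q∣ (x n) (x N))
                        (+-monoˡ-≤ ∣ x N ∣ (<⇒≤ (h n N n≥N ℕP.≤-refl)))

infix  4 _≈_ _<ℝ_
infixl 6 _+ℝ_ _-ℝ_
infixl 7 _*ℝ_
infix  8 -ℝ_

↑_ : ℚ → ℝ
↑ q = mkℝ (λ _ → q) λ ε 0<ε → 0 , λ _ _ _ _ → subst (_< ε) (cong ∣_∣ (sym (+-inverseʳ q))) 0<ε

0ℝ 1ℝ : ℝ
0ℝ = ↑ 0ℚ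
1ℝ = ↑ 1ℚ

_≈_ : ℝ → ℝ → Set
x ≈ y = ∀ ε → 0ℚ < ε → ∃[ N ] ∀ n → n ≥ N → ∣ seq x n - seq y n ∣ < ε

_<ℝ_ : ℝ → ℝ → Set
x <ℝ y = ∃[ ε ] 0ℚ < ε × (∃[ N ] ∀ n → n ≥ N → seq x n + ε ≤ seq y n)

-ℝ_ : ℝ → ℝ
-ℝ x = mkℝ (λ n → - seq x n) λ ε 0<ε → let N , h = cauchy x ε 0<ε in
  N , λ m n m≥N n≥N → subst (_< ε)
    (trans (∣-∣-sym (seq x m) (seq x n))
      (cong ∣_∣ (neg-neg-sub (seq x m) (seq x n))))
    (h m n m≥N n≥N)

_+ℝ_ : ℝ → ℝ → ℝ
mkℝ x cx +ℝ mkℝ y cy = mkℝ (λ n → x n + y n) (mkCauchy {λ n → x n + y n} (1ℚ + 1ℚ) (positive⁻¹ (1ℚ + 1ℚ)) λ ε 0<ε →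
  let N , h = cx ε 0<ε
      M , g = cy ε 0<ε
  in N ℕ.⊔ M , λ m n n≥ m≥n →
    let n≥N = ℕP.≤-trans (ℕP.m≤m⊔n N M) n≥
        n≥M = ℕP.≤-trans (ℕP.m≤n⊔m N M) n≥
    in begin
      ∣ (x m + y m) - (x n + y n) ∣
        ≡⟨ cong ∣_∣ (interchange (x m) (y m) (x n) (y n)) ⟩
      ∣ (x m - x n) + (y m - y n) ∣
        ≤⟨ ∣p+q∣≤∣p∣+∣q∣ (x m - x n) (y m - y n) ⟩
      ∣ x m - x n ∣ + ∣ y m - y n ∣
        ≤⟨ +-mono-≤ (<⇒≤ (h m n (ℕP.≤-trans n≥N m≥n) n≥N)) (<⇒≤ (g m n (ℕP.≤-trans n≥M m≥n) n≥M)) ⟩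
      ε + ε
        ≡⟨ double ε ⟩
      (1ℚ + 1ℚ) * ε ∎)
  where open ≤-Reasoning

_-ℝ_ : ℝ → ℝ → ℝ
x -ℝ y = x +ℝ -ℝ y

*-cauchy : ∀ {x y} → Cauchy x → Cauchy y → Cauchy (λ n → x n * y n)
*-cauchy {x} {y} cx cy =
  let K , 0<K , Nx , bx = bounded {x} cx
      L , 0<L , Ny , by = bounded {y} cy
  in mkCauchy {λ n → x n * y n} (K + L) (+-mono-< 0<K 0<L) λ ε 0<ε →
  let N , h = cx ε 0<ε
      M , g = cy ε 0<ε
  in (N ℕ.⊔ M) ℕ.⊔ (Nx ℕ.⊔ Ny) , λ m n n≥ m≥n →
    let n≥N⊔M   = ℕP.≤-trans (ℕP.m≤m⊔n (N ℕ.⊔ M) (Nx ℕ.⊔ Ny)) n≥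
        n≥Nx⊔Ny = ℕP.≤-trans (ℕP.m≤n⊔m (N ℕ.⊔ M) (Nx ℕ.⊔ Ny)) n≥
        n≥N     = ℕP.≤-trans (ℕP.m≤m⊔n N M) n≥N⊔M
        n≥M     = ℕP.≤-trans (ℕP.m≤n⊔m N M) n≥N⊔M
        n≥Nx    = ℕP.≤-trans (ℕP.m≤m⊔n Nx Ny) n≥Nx⊔Ny
        n≥Ny    = ℕP.≤-trans (ℕP.m≤n⊔m Nx Ny) n≥Nx⊔Ny
    in begin
      ∣ x m * y m - x n * y n ∣
        ≡⟨ cong ∣_∣ (product-sub (x m) (y m) (x n) (y n)) ⟩
      ∣ x m * (y m - y n) + (x m - x n) * y n ∣
        ≤⟨ ∣p+q∣≤∣p∣+∣q∣ (x m * (y m - y n)) ((x m - x n) * y n) ⟩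
      ∣ x m * (y m - y n) ∣ + ∣ (x m - x n) * y n ∣
        ≡⟨ cong₂ _+_ (∣p*q∣≡∣p∣*∣q∣ (x m) (y m - y n)) (∣p*q∣≡∣p∣*∣q∣ (x m - x n) (y n)) ⟩
      ∣ x m ∣ * ∣ y m - y n ∣ + ∣ x m - x n ∣ * ∣ y n ∣
        ≤⟨ +-mono-≤
             (*-mono-≤₀ (<⇒≤ 0<K) (0≤∣p∣ (y m - y n)) (bx m (ℕP.≤-trans n≥Nx m≥n)) (<⇒≤ (g m n (ℕP.≤-trans n≥M m≥n) n≥M)))
             (*-mono-≤₀ (<⇒≤ 0<ε) (0≤∣p∣ (y n)) (<⇒≤ (h m n (ℕP.≤-trans n≥N m≥n) n≥N)) (by n n≥Ny)) ⟩
      K * ε + ε * L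
        ≡⟨ product-bound K L ε ⟩
      (K + L) * ε ∎
  where open ≤-Reasoning

_*ℝ_ : ℝ → ℝ → ℝ
x *ℝ y = mkℝ (λ n → seq x n * seq y n) (*-cauchy {seq x} {seq y} (cauchy x) (cauchy y))

∣_∣ℝ : ℝ → ℝ
∣ x ∣ℝ = mkℝ (λ n → ∣ seq x n ∣) λ ε 0<ε → let N , h = cauchy x ε 0<ε in
  N , λ m n m≥N n≥N → ≤-<-trans (∣∣p∣-∣q∣∣≤∣p-q∣ (seq x m) (seq x n)) (h m n m≥N n≥N)

infix 4 _⟶_

_⟶_ : (ℕ → ℝ) → ℝ → Set
a ⟶ L = ∀ ε → 0ℝ <ℝ ε → ∃[ N ] ∀ n → n ≥ N → ∣ a n -ℝ L ∣ℝ <ℝ ε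

------------------------------------------------------------------------
-- Exponential function

∑< : ℕ → (ℕ → ℚ) → ℚ
∑< zero    f = 0ℚ
∑< (suc n) f = ∑< n f + f n

-- expTerm a k = aᵏ / k!
expTerm : ℚ → ℕ → ℚ
expTerm a zero    = 1ℚ
expTerm a (suc k) = expTerm a k * a * recip k

expSum : ℚ → ℕ → ℚ
expSum a n = ∑< n (expTerm a)

module _ {K : ℚ} (0≤K : 0ℚ ≤ K) (M : ℕ) (2K≤M : K + K ≤ ι M) where

  open ≤-Reasoning

  private
    t = expTerm K
    S = expSum K

  0≤t : ∀ k → 0ℚ ≤ t k
  0≤t zero    = nonNegative⁻¹ 1ℚ
  0≤t (suc k) = 0≤* (0≤* (0≤t k) 0≤K) (0≤recip k)

  0≤S : ∀ n → 0ℚ ≤ S n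
  0≤S zero    = ≤-refl
  0≤S (suc n) = 0≤+ (0≤S n) (0≤t n)

  ∣expTerm∣≤ : ∀ {a} → ∣ a ∣ ≤ K → ∀ k → ∣ expTerm a k ∣ ≤ t k
  ∣expTerm∣≤ {a} a≤K zero    = ≤-refl
  ∣expTerm∣≤ {a} a≤K (suc k) = begin
    ∣ expTerm a k * a * recip k ∣        ≡⟨ ∣p*q∣≡∣p∣*∣q∣ (expTerm a k * a) (recip k) ⟩
    ∣ expTerm a k * a ∣ * ∣ recip k ∣    ≡⟨ cong₂ _*_ (∣p*q∣≡∣p∣*∣q∣ (expTerm a k) a) (0≤p⇒∣p∣≡p (0≤recip k)) ⟩
    ∣ expTerm a k ∣ * ∣ a ∣ * recip k    ≤⟨ *-monoʳ-≤-nonNeg (recip k) {{nonNegative (0≤recip k)}}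
                                              (*-mono-≤₀ (0≤t k) (0≤∣p∣ a) (∣expTerm∣≤ a≤K k) a≤K) ⟩
    t k * K * recip k                    ∎

  private
    t-step : ∀ k → t (suc k) * ι (suc k) ≡ t k * K
    t-step k = trans
      (rotate (t k * K) (recip k) (ι (suc k)))
      (trans (cong (t k * K *_) (recip-inverseʳ k)) (*-identityʳ _))

  expTerm-lipschitz : ∀ {a b} → ∣ a ∣ ≤ K → ∣ b ∣ ≤ K → ∀ k →
                      ∣ expTerm a (suc k) - expTerm b (suc k) ∣ ≤ t k * ∣ a - b ∣
  expTerm-lipschitz {a} {b} a≤K b≤K zero = ≤-reflexive (trans
    (cong ∣_∣ (one-term a b))
    (sym (*-identityˡ ∣ a - b ∣)))
  expTerm-lipschitz {a} {b} a≤K b≤K (suc k) = begin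
    ∣ u * a * r - v * b * r ∣
      ≡⟨ cong ∣_∣ (term-sub u v a b r) ⟩
    ∣ ((u - v) * a + v * (a - b)) * r ∣
      ≡⟨ trans (∣p*q∣≡∣p∣*∣q∣ ((u - v) * a + v * (a - b)) r)
               (cong (∣ (u - v) * a + v * (a - b) ∣ *_) (0≤p⇒∣p∣≡p (0≤recip (suc k)))) ⟩
    ∣ (u - v) * a + v * (a - b) ∣ * r
      ≤⟨ *-monoʳ-≤-nonNeg r {{nonNegative (0≤recip (suc k))}} (begin
           ∣ (u - v) * a + v * (a - b) ∣
             ≤⟨ ∣p+q∣≤∣p∣+∣q∣ ((u - v) * a) (v * (a - b)) ⟩
           ∣ (u - v) * a ∣ + ∣ v * (a - b) ∣
             ≡⟨ cong₂ _+_ (∣p*q∣≡∣p∣*∣q∣ (u - v) a) (∣p*q∣≡∣p∣*∣q∣ v (a - b)) ⟩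
           ∣ u - v ∣ * ∣ a ∣ + ∣ v ∣ * d
             ≤⟨ +-mono-≤
                  (*-mono-≤₀ (0≤* (0≤t k) 0≤d) (0≤∣p∣ a) (expTerm-lipschitz a≤K b≤K k) a≤K)
                  (*-monoʳ-≤-nonNeg d {{nonNegative 0≤d}} (∣expTerm∣≤ b≤K (suc k))) ⟩
           t k * d * K + t (suc k) * d
             ≡⟨ swap-mid (t k) d K (t (suc k) * d) ⟩
           t k * K * d + t (suc k) * d
             ≡⟨ cong (λ z → z * d + t (suc k) * d) (t-step k) ⟨
           t (suc k) * ι (suc k) * d + t (suc k) * d
             ≡⟨ collect (t (suc k)) (ι (suc k)) d ⟩
           t (suc k) * d * (ι (suc k) + 1ℚ)
             ≡⟨ cong (t (suc k) * d *_) (ι-suc (suc k)) ⟨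
           t (suc k) * d * ι (suc (suc k)) ∎) ⟩
    t (suc k) * d * ι (suc (suc k)) * r
      ≡⟨ *-assoc (t (suc k) * d) (ι (suc (suc k))) r ⟩
    t (suc k) * d * (ι (suc (suc k)) * r)
      ≡⟨ cong (t (suc k) * d *_) (recip-inverseʳ (suc k)) ⟩
    t (suc k) * d * 1ℚ
      ≡⟨ *-identityʳ _ ⟩
    t (suc k) * d ∎
    where
    u = expTerm a (suc k)
    v = expTerm b (suc k)
    r = recip (suc k)
    d = ∣ a - b ∣
    0≤d = 0≤∣p∣ (a - b)

  expSum-lipschitz : ∀ {a b} → ∣ a ∣ ≤ K → ∣ b ∣ ≤ K → ∀ n →
                     ∣ expSum a n - expSum b n ∣ ≤ S n * ∣ a - b ∣
  expSum-lipschitz {a} {b} a≤K b≤K zero = ≤-reflexive (sym (*-zeroˡ ∣ a - b ∣))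
  expSum-lipschitz {a} {b} a≤K b≤K (suc n) = begin
    ∣ expSum a (suc n) - expSum b (suc n) ∣  ≤⟨ go n ⟩
    S n * d                                  ≤⟨ *-monoʳ-≤-nonNeg d {{nonNegative (0≤∣p∣ (a - b))}}
                                                  (subst (_≤ S n + t n) (+-identityʳ (S n)) (+-monoʳ-≤ (S n) (0≤t n))) ⟩
    S (suc n) * d                            ∎
    where
    d = ∣ a - b ∣
    go : ∀ n → ∣ expSum a (suc n) - expSum b (suc n) ∣ ≤ S n * d
    go zero    = ≤-reflexive (sym (*-zeroˡ d))
    go (suc n) = begin
      ∣ (p + u) - (q + v) ∣          ≡⟨ cong ∣_∣ (interchange p u q v) ⟩
      ∣ (p - q) + (u - v) ∣          ≤⟨ ∣p+q∣≤∣p∣+∣q∣ (p - q) (u - v) ⟩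
      ∣ p - q ∣ + ∣ u - v ∣          ≤⟨ +-mono-≤ (go n) (expTerm-lipschitz a≤K b≤K n) ⟩
      S n * d + t n * d              ≡⟨ *-distribʳ-+ d (S n) (t n) ⟨
      S (suc n) * d                  ∎
      where
      p = expSum a (suc n)
      q = expSum b (suc n)
      u = expTerm a (suc n)
      v = expTerm b (suc n)

  expSum-tail : ∀ {a} → ∣ a ∣ ≤ K → ∀ {m n} → n ℕ.≤′ m →
                ∣ expSum a m - expSum a n ∣ ≤ S m - S n
  expSum-tail {a} a≤K {m} {n} (ℕ.≤′-reflexive refl) = ≤-reflexive
    (trans (cong ∣_∣ (+-inverseʳ (expSum a n))) (sym (+-inverseʳ (S n))))
  expSum-tail {a} a≤K {suc m} {n} (ℕ.≤′-step n≤m) = begin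
    ∣ (p + u) - q ∣          ≡⟨ cong ∣_∣ (add-sub-comm p u q) ⟩
    ∣ (p - q) + u ∣          ≤⟨ ∣p+q∣≤∣p∣+∣q∣ (p - q) u ⟩
    ∣ p - q ∣ + ∣ u ∣        ≤⟨ +-mono-≤ (expSum-tail a≤K n≤m) (∣expTerm∣≤ a≤K m) ⟩
    (S m - S n) + t m        ≡⟨ add-sub-comm (S m) (t m) (S n) ⟨
    (S m + t m) - S n        ∎
    where
    p = expSum a m
    q = expSum a n
    u = expTerm a m

  t-halves : ∀ {k} → k ≥ M → t (suc k) + t (suc k) ≤ t k
  t-halves {k} k≥M = begin
    t k * K * r + t k * K * r   ≡⟨ double-term (t k) K r ⟩
    t k * ((K + K) * r)         ≤⟨ *-monoˡ-≤-nonNeg (t k) {{nonNegative (0≤t k)}}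
                                     (*-monoʳ-≤-nonNeg r {{nonNegative (0≤recip k)}}
                                       (≤-trans 2K≤M (ι-mono (ℕP.m≤n⇒m≤1+n k≥M)))) ⟩
    t k * (ι (suc k) * r)       ≡⟨ trans (cong (t k *_) (recip-inverseʳ k)) (*-identityʳ (t k)) ⟩
    t k                         ∎
    where r = recip k

  t-decr : ∀ {n} → M ℕ.≤′ n → t n ≤ t M
  t-decr (ℕ.≤′-reflexive refl) = ≤-refl
  t-decr {suc n} (ℕ.≤′-step M≤n) = begin
    t (suc n)              ≡⟨ +-identityʳ (t (suc n)) ⟨
    t (suc n) + 0ℚ         ≤⟨ +-monoʳ-≤ (t (suc n)) (0≤t (suc n)) ⟩
    t (suc n) + t (suc n)  ≤⟨ t-halves (ℕP.≤′⇒≤ M≤n) ⟩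
    t n                    ≤⟨ t-decr M≤n ⟩
    t M                    ∎

  private
    U : ℕ → ℚ
    U n = S n + (t n + t n)

  U-decr : ∀ {m n} → n ≥ M → n ℕ.≤′ m → U m ≤ U n
  U-decr n≥M (ℕ.≤′-reflexive refl) = ≤-refl
  U-decr {suc m} {n} n≥M (ℕ.≤′-step n≤m) = begin
    (S m + t m) + (t (suc m) + t (suc m))  ≤⟨ +-monoʳ-≤ (S m + t m) (t-halves (ℕP.≤-trans n≥M (ℕP.≤′⇒≤ n≤m))) ⟩
    (S m + t m) + t m                      ≡⟨ +-assoc (S m) (t m) (t m) ⟩
    U m                                    ≤⟨ U-decr n≥M n≤m ⟩
    U n                                    ∎

  S≤U : ∀ n → S n ≤ U n
  S≤U n = subst (_≤ U n) (+-identityʳ (S n)) (+-monoʳ-≤ (S n) (0≤+ (0≤t n) (0≤t n)))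

  S-tail : ∀ {m n} → n ≥ M → n ℕ.≤ m → S m - S n ≤ t n + t n
  S-tail {m} {n} n≥M n≤m = ≤+⇒-≤ (begin
    S m                ≤⟨ S≤U m ⟩
    U m                ≤⟨ U-decr n≥M (ℕP.≤⇒≤′ n≤m) ⟩
    S n + (t n + t n)  ≡⟨ +-comm (S n) (t n + t n) ⟩
    (t n + t n) + S n  ∎)

  t-small : ∀ {ε} → 0ℚ < ε → ∃[ N ] ∀ n → n ≥ N → t n ≤ ε
  t-small {ε} 0<ε =
    let c , tMK≤c = archimedean (t M * K)
        k , rk≤   = recip-small (0<* 0<ε (0<recip c))
    in suc (M ℕ.⊔ k) , bound c k tMK≤c rk≤
    where
    bound : ∀ c k → t M * K ≤ ι c → recip k ≤ ε * recip c →
            ∀ n → n ≥ suc (M ℕ.⊔ k) → t n ≤ ε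
    bound c k tMK≤c rk≤ (suc n) (ℕ.s≤s n≥) = begin
      t n * K * recip n         ≤⟨ *-monoʳ-≤-nonNeg (recip n) {{nonNegative (0≤recip n)}}
                                     (*-monoʳ-≤-nonNeg K {{nonNegative 0≤K}}
                                       (t-decr (ℕP.≤⇒≤′ (ℕP.≤-trans (ℕP.m≤m⊔n M k) n≥)))) ⟩
      t M * K * recip n         ≤⟨ *-mono-≤₀ (≤-trans 0≤tMK tMK≤) (0≤recip n) tMK≤
                                     (≤-trans (recip-anti (ℕP.≤-trans (ℕP.m≤n⊔m M k) n≥)) rk≤) ⟩
      ι (suc c) * (ε * recip c) ≡⟨ swap-front (ι (suc c)) ε (recip c) ⟩
      ε * (ι (suc c) * recip c) ≡⟨ trans (cong (ε *_) (recip-inverseʳ c)) (*-identityʳ ε) ⟩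
      ε                         ∎
      where
      0≤tMK = 0≤* (0≤t M) 0≤K
      tMK≤ = ≤-trans tMK≤c (ι-mono (ℕP.n≤1+n c))

  exp-cauchy : ∀ {x} N₀ → Cauchy x → (∀ n → n ≥ N₀ → ∣ x n ∣ ≤ K) → Cauchy (λ n → expSum (x n) n)
  exp-cauchy {x} N₀ cx bx = mkCauchy {λ n → expSum (x n) n} (D + (1ℚ + 1ℚ)) 0<C λ ε 0<ε →
    let N₁ , h = cx ε 0<ε
        N₂ , g = t-small 0<ε
    in (N₀ ℕ.⊔ N₁) ℕ.⊔ (N₂ ℕ.⊔ M) , λ m n n≥ m≥n →
      let n≥₀₁ = ℕP.≤-trans (ℕP.m≤m⊔n (N₀ ℕ.⊔ N₁) (N₂ ℕ.⊔ M)) n≥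
          n≥₂₃ = ℕP.≤-trans (ℕP.m≤n⊔m (N₀ ℕ.⊔ N₁) (N₂ ℕ.⊔ M)) n≥
          n≥₀  = ℕP.≤-trans (ℕP.m≤m⊔n N₀ N₁) n≥₀₁
          n≥₁  = ℕP.≤-trans (ℕP.m≤n⊔m N₀ N₁) n≥₀₁
          n≥₂  = ℕP.≤-trans (ℕP.m≤m⊔n N₂ M) n≥₂₃
          n≥M  = ℕP.≤-trans (ℕP.m≤n⊔m N₂ M) n≥₂₃
          xm≤K = bx m (ℕP.≤-trans n≥₀ m≥n)
      in begin
        ∣ expSum (x m) m - expSum (x n) n ∣
          ≤⟨ ∣-∣-triangle (expSum (x m) m) (expSum (x m) n) (expSum (x n) n) ⟩
        ∣ expSum (x m) m - expSum (x m) n ∣ + ∣ expSum (x m) n - expSum (x n) n ∣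
          ≤⟨ +-mono-≤
               (≤-trans (expSum-tail xm≤K (ℕP.≤⇒≤′ m≥n))
                 (≤-trans (S-tail n≥M m≥n) (+-mono-≤ (g n n≥₂) (g n n≥₂))))
               (≤-trans (expSum-lipschitz xm≤K (bx n n≥₀) n)
                 (*-mono-≤₀ 0≤D (0≤∣p∣ (x m - x n))
                   (≤-trans (S≤U n) (U-decr ℕP.≤-refl (ℕP.≤⇒≤′ n≥M)))
                   (<⇒≤ (h m n (ℕP.≤-trans n≥₁ m≥n) n≥₁)))) ⟩
        (ε + ε) + D * ε
          ≡⟨ exp-bound ε D ⟩
        (D + (1ℚ + 1ℚ)) * ε ∎
    where
    D = U M
    0≤D = ≤-trans (0≤S M) (S≤U M)
    0<C : 0ℚ < D + (1ℚ + 1ℚ)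
    0<C = +-mono-≤-< 0≤D (positive⁻¹ (1ℚ + 1ℚ))

-- exp x = Σ_k xᵏ / k!, computed along the diagonal: the n-th approximation is
-- the n-th partial sum evaluated at the n-th approximation of x.
exp : ℝ → ℝ
exp (mkℝ x cx) = mkℝ (λ n → expSum (x n) n)
  (let K , 0<K , N , bx = bounded {x} cx 
       M , 2K≤M = archimedean (K + K)
   in exp-cauchy (<⇒≤ 0<K) M 2K≤M {x} N cx bx)

------------------------------------------------------------------------
-- Logarithm of a positive integer and its real powers

-- The right-endpoint Riemann sum of ∫₁ⁿ dt/t with mesh 1/m:
-- Σ_{i < (n-1)m} (1/m) · 1/(1 + (i+1)/m).
lnSum : ℕ → ℕ → ℚ
lnSum n m = ∑< ((n ∸ 1) ℕ.* m) λ i → recip (m ℕ.+ i)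

H : ℕ → ℚ
H n = ∑< n recip

H-+ : ∀ m c → H (m ℕ.+ c) ≡ H m + ∑< c (λ i → recip (m ℕ.+ i))
H-+ m zero    = trans (cong H (ℕP.+-identityʳ m)) (sym (+-identityʳ (H m)))
H-+ m (suc c) = trans (cong H (ℕP.+-suc m c))
  (trans (cong (_+ recip (m ℕ.+ c)) (H-+ m c)) (+-assoc (H m) _ _))

∑<-upper : ∀ c (f : ℕ → ℚ) b → (∀ i → i ℕ.< c → f i ≤ b) → ∑< c f ≤ ι c * b
∑<-upper zero    f b h = ≤-reflexive (sym (*-zeroˡ b))
∑<-upper (suc c) f b h = ≤-trans
  (+-mono-≤ (∑<-upper c f b λ i i<c → h i (ℕP.m≤n⇒m≤1+n i<c)) (h c ℕP.≤-refl))
  (≤-reflexive (trans (suc-mult (ι c) b)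
                      (cong (_* b) (sym (ι-suc c)))))

∑<-lower : ∀ c (f : ℕ → ℚ) b → (∀ i → i ℕ.< c → b ≤ f i) → ι c * b ≤ ∑< c f
∑<-lower zero    f b h = ≤-reflexive (*-zeroˡ b)
∑<-lower (suc c) f b h = ≤-trans
  (≤-reflexive (trans (cong (_* b) (ι-suc c))
                      (sym (suc-mult (ι c) b))))
  (+-mono-≤ (∑<-lower c f b λ i i<c → h i (ℕP.m≤n⇒m≤1+n i<c)) (h c ℕP.≤-refl))

recip-* : ∀ k j → ι (suc k) * recip (j ℕ.+ k ℕ.* suc j) ≡ recip j
recip-* k j = toℚᵘ-injective (begin
  toℚᵘ (ι (suc k) * recip l)                 ≈⟨ toℚᵘ-homo-* (ι (suc k)) (recip l) ⟩
  toℚᵘ (ι (suc k)) ℚᵘ.* toℚᵘ (recip l)       ≈⟨ ℚᵘP.*-cong (toℚᵘ-fromℚᵘ (ℚᵘ.mkℚᵘ (+ suc k) 0)) (toℚᵘ-fromℚᵘ (ℚᵘ.mkℚᵘ (+ 1) l)) ⟩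
  ℚᵘ.mkℚᵘ (+ suc k) 0 ℚᵘ.* ℚᵘ.mkℚᵘ (+ 1) l   ≈⟨ ℚᵘ.*≡* (cong +_ (lem k j)) ⟩
  ℚᵘ.mkℚᵘ (+ 1) j                            ≈⟨ toℚᵘ-fromℚᵘ (ℚᵘ.mkℚᵘ (+ 1) j) ⟨
  toℚᵘ (recip j)                             ∎)
  where
  open ℚᵘP.≃-Reasoning
  l = j ℕ.+ k ℕ.* suc j
  lem : ∀ k j → suc k ℕ.* 1 ℕ.* suc j ≡ 1 ℕ.* (1 ℕ.* suc (j ℕ.+ k ℕ.* suc j))
  lem = ℕSolver.solve-∀

module _ (k : ℕ) where
  open ≤-Reasoning

  R : ℕ → ℚ
  R m = ∑< (k ℕ.* m) λ i → recip (m ℕ.+ i)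

  block : ℕ → ℚ
  block m = ∑< (suc k) λ i → recip ((m ℕ.+ k ℕ.* m) ℕ.+ i)

  R-step : ∀ m → R (suc m) + recip m ≡ R m + block m
  R-step m = begin-equality
    R (suc m) + recip m
      ≡⟨ insert (H m) (recip m) (R (suc m)) ⟩
    (H (suc m) + R (suc m)) - H m
      ≡⟨ cong (_- H m) (H-+ (suc m) (k ℕ.* suc m)) ⟨
    H (suc m ℕ.+ k ℕ.* suc m) - H m
      ≡⟨ cong (λ z → H z - H m) (lem k m) ⟩
    H ((m ℕ.+ k ℕ.* m) ℕ.+ suc k) - H m
      ≡⟨ cong (_- H m) (trans (H-+ (m ℕ.+ k ℕ.* m) (suc k)) (cong (_+ block m) (H-+ m (k ℕ.* m)))) ⟩
    (H m + R m + block m) - H m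
      ≡⟨ remove (H m) (R m) (block m) ⟩
    R m + block m ∎
    where
    lem : ∀ k m → suc m ℕ.+ k ℕ.* suc m ≡ (m ℕ.+ k ℕ.* m) ℕ.+ suc k
    lem = ℕSolver.solve-∀

  block-lower : ∀ m → recip m ≤ block m
  block-lower m = subst (_≤ block m) (recip-* k m)
    (∑<-lower (suc k) _ _ λ i i<1+k → recip-anti (index≤ i i<1+k))
    where
    lem : ∀ k m → (m ℕ.+ k ℕ.* m) ℕ.+ k ≡ m ℕ.+ k ℕ.* suc m
    lem = ℕSolver.solve-∀
    index≤ : ∀ i → i ℕ.< suc k → (m ℕ.+ k ℕ.* m) ℕ.+ i ℕ.≤ m ℕ.+ k ℕ.* suc m
    index≤ i (ℕ.s≤s i≤k) = subst ((m ℕ.+ k ℕ.* m) ℕ.+ i ℕ.≤_) (lem k m)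
      (ℕP.+-monoʳ-≤ (m ℕ.+ k ℕ.* m) i≤k)

  block-upper : ∀ m → block (suc m) ≤ recip m
  block-upper m = subst (block (suc m) ≤_) (recip-* k m)
    (∑<-upper (suc k) _ _ λ i _ → recip-anti
      (ℕP.≤-trans (ℕP.n≤1+n (m ℕ.+ k ℕ.* suc m)) (ℕP.m≤m+n (suc (m ℕ.+ k ℕ.* suc m)) i)))

  R-incr : ∀ {m n} → n ℕ.≤′ m → R n ≤ R m
  R-incr (ℕ.≤′-reflexive refl) = ≤-refl
  R-incr {suc m} {n} (ℕ.≤′-step n≤m) = ≤-trans (R-incr n≤m) (begin
    R m                             ≡⟨ add-sub (R m) (recip m) ⟨
    (R m + recip m) - recip m       ≤⟨ +-monoˡ-≤ (- recip m) (+-monoʳ-≤ (R m) (block-lower m)) ⟩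
    (R m + block m) - recip m       ≡⟨ cong (_- recip m) (R-step m) ⟨
    (R (suc m) + recip m) - recip m ≡⟨ add-sub (R (suc m)) (recip m) ⟩
    R (suc m)                       ∎)

  R+recip-decr : ∀ {m n} → n ℕ.≤′ m → R (suc m) + recip m ≤ R (suc n) + recip n
  R+recip-decr (ℕ.≤′-reflexive refl) = ≤-refl
  R+recip-decr {suc m} {n} (ℕ.≤′-step n≤m) = begin
    R (suc (suc m)) + recip (suc m)  ≡⟨ R-step (suc m) ⟩
    R (suc m) + block (suc m)        ≤⟨ +-monoʳ-≤ (R (suc m)) (block-upper m) ⟩
    R (suc m) + recip m              ≤⟨ R+recip-decr n≤m ⟩
    R (suc n) + recip n              ∎

  R-cauchy : Cauchy R
  R-cauchy = mkCauchy {R} 1ℚ (positive⁻¹ 1ℚ) λ ε 0<ε →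
    let l , rl≤ε = recip-small 0<ε in suc l , bound ε l rl≤ε
    where
    bound : ∀ ε l → recip l ≤ ε → ∀ m n → n ≥ suc l → m ≥ n → ∣ R m - R n ∣ ≤ 1ℚ * ε
    bound ε l rl≤ε (suc m) (suc n) (ℕ.s≤s n≥l) (ℕ.s≤s m≥n) = begin
      ∣ R (suc m) - R (suc n) ∣  ≡⟨ 0≤p⇒∣p∣≡p (p≤q⇒0≤q-p (R-incr (ℕP.≤⇒≤′ (ℕ.s≤s m≥n)))) ⟩
      R (suc m) - R (suc n)      ≤⟨ ≤+⇒-≤ (begin
        R (suc m)                  ≡⟨ +-identityʳ (R (suc m)) ⟨
        R (suc m) + 0ℚ             ≤⟨ +-monoʳ-≤ (R (suc m)) (0≤recip m) ⟩
        R (suc m) + recip m        ≤⟨ R+recip-decr (ℕP.≤⇒≤′ m≥n) ⟩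
        R (suc n) + recip n        ≡⟨ +-comm (R (suc n)) (recip n) ⟩
        recip n + R (suc n)        ∎) ⟩
      recip n                    ≤⟨ recip-anti n≥l ⟩
      recip l                    ≤⟨ rl≤ε ⟩
      ε                          ≡⟨ *-identityˡ ε ⟨
      1ℚ * ε                     ∎

-- ln n = ∫₁ⁿ dt/t for n ≥ 1; ln 0 is a junk value.
ln : ℕ → ℝ
ln n = mkℝ (lnSum n) (R-cauchy (n ∸ 1))

infixr 8 _^ℝ_

_^ℝ_ : ℕ → ℝ → ℝ
n ^ℝ β = exp (β *ℝ ln n)

------------------------------------------------------------------------
-- The shuffle

data Place : Set where
  top bottom : Place

put : ℕ × Place → List ℕ → List ℕ
put (c , top)    pile = c ∷ pile
put (c , bottom) pile = pile ∷ʳ c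

-- The i-th entry of the outcome is the place given to the card in the i-th
-- position from the top; foldr handles the bottom card first.
shuffle : ∀ {n} → Vec ℕ n → Vec Place n → List ℕ
shuffle deck ω = Vec.foldr _ put [] (zip deck ω)

orderedDeck : ∀ n → Vec ℕ n
orderedDeck n = tabulate (suc ∘ toℕ)

outcomes : ∀ n → List (Vec Place n)
outcomes zero    = [] ∷ []
outcomes (suc n) = map (top ∷_) (outcomes n) ++ map (bottom ∷_) (outcomes n)

placeWeight : ℝ → Place → ℝ
placeWeight p top    = p
placeWeight p bottom = 1ℝ -ℝ p

weight : ∀ {n} → ℝ → Vec Place n → ℝ
weight p ω = Vec.foldr _ (λ d w → placeWeight p d *ℝ w) 1ℝ ω

ℙ : ∀ {n} {E : Pred (Vec Place n) 0ℓ} → ℝ → Decidable E → ℝ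
ℙ p E? = foldr (λ ω s → weight p ω +ℝ s) 0ℝ (filter E? (outcomes _))

------------------------------------------------------------------------
-- The guessing game (strategy for p ≥ ½)

-- Cards already shown are listed with the most recent one first.
largestUnseen : ℕ → List ℕ → ℕ
largestUnseen n shown = max 0 (filter (λ c → _∉?_ ℕ._≟_ c shown) (map suc (upTo n)))

guess : ℕ → List ℕ → ℕ
guess n []            = 1
guess n shown@(c ∷ _) =
  if does (_∈?_ ℕ._≟_ (n ∸ 1) shown) ∨ does (_∈?_ ℕ._≟_ n shown)
  then largestUnseen n shown
  else suc c

correctGuesses : ℕ → List ℕ → List ℕ → ℕ
correctGuesses n shown []         = 0
correctGuesses n shown (c ∷ deck) =
  (if does (guess n shown ℕ.≟ c) then 1 else 0) ℕ.+ correctGuesses n (c ∷ shown) deck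

X : ∀ n → Vec Place n → ℕ
X n ω = correctGuesses n [] (shuffle (orderedDeck n) ω)

{-# OPTIONS --safe #-}
-- All guesses are correct exactly when every card except possibly card n is put on
-- top, so ℙ{Xₙ = n} = pₙⁿ⁻¹ = (1 - x)ⁿ⁻¹ with x = λ n^(-α), and everything depends on
-- the size of n x.  If n x → 0, Bernoulli's inequality gives the limit 1; if
-- n x → ∞, the bound (1 - x)ⁿ⁻¹ (1 + (n-1) x) ≤ 1 gives the limit 0; if n x → λ, compare
-- with (1 - λ/n)ⁿ ≤ exp (- λ) ≤ (1 + λ/n)⁻ⁿ.
-- The size of n x is found from the tangent inequality exp u ≥ exp v (1 + u - v) at
-- u, v ∈ {ln n, α ln n}, from exp (ln n) = n and from exp (- y) exp y = 1.  All
-- inequalities are proved for partial sums of the exponential series, at the level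
-- of the rational approximations.

module Submission where

open import Data.Fin using (Fin; toℕ)
open import Data.List using (List; []; _∷_; _∷ʳ_; _++_; length; filter; map; foldr; upTo; downFrom)
open import Data.List.Extrema.Nat using (max≈v⁺)
open import Data.List.Membership.DecPropositional using (_∈?_; _∉?_)
open import Data.List.Membership.Propositional using (_∉_)
open import Data.List.Membership.Propositional.Properties using (∈-map⁺; ∈-filter⁺; ∈-upTo⁺)
open import Data.List.Properties using (filter-++; filter-all; filter-none; length-++; ++-identityʳ)
open import Data.List.Relation.Unary.All using (All; []; _∷_)
import Data.List.Relation.Unary.All as All
import Data.List.Relation.Unary.All.Properties as AllP
open import Data.List.Relation.Unary.Any using (here)
open import Data.Nat using (ℕ; zero; suc; _∸_; _≥_; _≟_; z≤n; s≤s)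
import Data.Nat as ℕ
import Data.Nat.Properties as ℕP
open import Data.Product using (∃-syntax; _×_; _,_; proj₁; proj₂)
open import Data.Rational using (ℚ; 0ℚ; 1ℚ; ½; _+_; _*_; -_; _-_; ∣_∣; _≤_; _<_; positive; nonNegative)
import Data.Rational as ℚ
open import Data.Rational.Properties hiding (_≟_)
open import Data.Sum using (inj₁; inj₂)
open import Data.Vec using (Vec; []; _∷_; tabulate)
open import Function using (_∘_)
open import Level using (0ℓ)
open import Relation.Binary.PropositionalEquality
open import Relation.Nullary using (contradiction; yes; no)
open import Relation.Nullary.Decidable using (dec⇒maybe; dec-true; dec-false)
open import Relation.Unary using (Pred; Decidable)
open import Tactic.RingSolver using (solve-∀)
open import Tactic.RingSolver.Core.AlmostCommutativeRing using (AlmostCommutativeRing; fromCommutativeRing)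
open import Defs

-- The m-th approximation of n^(-α) is a sum of m terms, evaluated at the m-th approximations of α
-- and ln n. Every limit thus reads "for large n, and then for large m depending on n", so in the
-- inner limit constants may depend on n. At a negative argument the partial sums of exp alternate
-- and have no evident sign or monotonicity. Convexity is therefore used at nonnegative arguments
-- only, where it survives truncation because the derivative of a partial sum is the sum with one
-- term less. Sign and size of the approximation of n^(-α) are read off from its product with the
-- partial sum at α ln n. For α different from 1 it suffices that this product lies between 1/2 and
-- 2, since the growth of ln n absorbs constant factors; for α = 1 it is needed up to ε. The
-- exponent n - 1 arises because card n meets an empty pile, whose top and bottom coincide.

ℚ-ring : AlmostCommutativeRing _ _
ℚ-ring = fromCommutativeRing +-*-commutativeRing (λ x → dec⇒maybe (0ℚ ℚ.≟ x))

-- Certificates for inequalities: b exceeds a by a nonnegative d, up to multiples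
-- of expressions e - f that vanish.
≤-cert : ∀ {a b} d → 0ℚ ≤ d → b ≡ a + d → a ≤ b
≤-cert {a} d 0≤d refl = subst (_≤ a + d) (+-identityʳ a) (+-monoʳ-≤ a 0≤d)

private
  vanish : ∀ a w e → a + w * (e - e) ≡ a
  vanish = solve-∀ ℚ-ring

≡-cert₁ : ∀ {a b e f} w → e ≡ f → b ≡ a + w * (e - f) → b ≡ a
≡-cert₁ {a} {e = e} w refl eq = trans eq (vanish a w e)

≤-cert₁ : ∀ {a b e f} d w → 0ℚ ≤ d → e ≡ f → b ≡ a + d + w * (e - f) → a ≤ b
≤-cert₁ d w 0≤d e≡f eq = ≤-cert d 0≤d (≡-cert₁ w e≡f eq)

≤-cert₂ : ∀ {a b e f e′ f′} d w w′ → 0ℚ ≤ d → e ≡ f → e′ ≡ f′ →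
          b ≡ a + d + w * (e - f) + w′ * (e′ - f′) → a ≤ b
≤-cert₂ d w w′ 0≤d e≡f e′≡f′ eq = ≤-cert₁ d w 0≤d e≡f (≡-cert₁ w′ e′≡f′ eq)

-- Order, integers and finite products in ℚ

0≤sub : ∀ {p q} → p ≤ q → 0ℚ ≤ q - p
0≤sub = p≤q⇒0≤q-p

0≤1 : 0ℚ ≤ 1ℚ
0≤1 = nonNegative⁻¹ 1ℚ

0≤square : ∀ x → 0ℚ ≤ x * x
0≤square x with ≤-total 0ℚ x
... | inj₁ 0≤x = 0≤* 0≤x 0≤x
... | inj₂ x≤0 = subst (0ℚ ≤_) (lem x) (0≤* (neg-antimono-≤ x≤0) (neg-antimono-≤ x≤0))
  where
  lem : ∀ x → - x * - x ≡ x * x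
  lem = solve-∀ ℚ-ring

ι-+ : ∀ m n → ι (m ℕ.+ n) ≡ ι m + ι n
ι-+ m zero    = trans (cong ι (ℕP.+-identityʳ m)) (sym (+-identityʳ (ι m)))
ι-+ m (suc n) = begin
  ι (m ℕ.+ suc n)     ≡⟨ cong ι (ℕP.+-suc m n) ⟩
  ι (suc (m ℕ.+ n))   ≡⟨ ι-suc (m ℕ.+ n) ⟩
  ι (m ℕ.+ n) + 1ℚ    ≡⟨ cong (_+ 1ℚ) (ι-+ m n) ⟩
  ι m + ι n + 1ℚ      ≡⟨ +-assoc (ι m) (ι n) 1ℚ ⟩
  ι m + (ι n + 1ℚ)    ≡⟨ cong (ι m +_) (ι-suc n) ⟨
  ι m + ι (suc n)     ∎
  where open ≡-Reasoning

ι-* : ∀ m n → ι (m ℕ.* n) ≡ ι m * ι n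
ι-* zero    n = sym (*-zeroˡ (ι n))
ι-* (suc m) n = begin
  ι (n ℕ.+ m ℕ.* n)    ≡⟨ ι-+ n (m ℕ.* n) ⟩
  ι n + ι (m ℕ.* n)    ≡⟨ cong (ι n +_) (ι-* m n) ⟩
  ι n + ι m * ι n      ≡⟨ lem (ι n) (ι m) ⟩
  (ι m + 1ℚ) * ι n     ≡⟨ cong (_* ι n) (ι-suc m) ⟨
  ι (suc m) * ι n      ∎
  where
  open ≡-Reasoning
  lem : ∀ n m → n + m * n ≡ (m + 1ℚ) * n
  lem = solve-∀ ℚ-ring

0≤ι : ∀ n → 0ℚ ≤ ι n
0≤ι n = ι-mono {0} {n} z≤n

∏< : ℕ → (ℕ → ℚ) → ℚ
∏< zero    f = 1ℚ
∏< (suc n) f = ∏< n f * f n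

∑<-nonneg : ∀ n {f} → (∀ i → 0ℚ ≤ f i) → 0ℚ ≤ ∑< n f
∑<-nonneg zero    h = ≤-refl
∑<-nonneg (suc n) h = 0≤+ (∑<-nonneg n h) (h n)

∏<-nonneg : ∀ n {f} → (∀ i → 0ℚ ≤ f i) → 0ℚ ≤ ∏< n f
∏<-nonneg zero    h = 0≤1
∏<-nonneg (suc n) h = 0≤* (∏<-nonneg n h) (h n)

-- The exponential series

expTerm-nonneg : ∀ {x} → 0ℚ ≤ x → ∀ k → 0ℚ ≤ expTerm x k
expTerm-nonneg 0≤x zero    = 0≤1
expTerm-nonneg 0≤x (suc k) = 0≤* (0≤* (expTerm-nonneg 0≤x k) 0≤x) (0≤recip k)

expSum-nonneg : ∀ {x} → 0ℚ ≤ x → ∀ m → 0ℚ ≤ expSum x m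
expSum-nonneg 0≤x m = ∑<-nonneg m (expTerm-nonneg 0≤x)

expTerm-step : ∀ x k → ι (suc k) * expTerm x (suc k) ≡ expTerm x k * x
expTerm-step x k = ≡-cert₁ (expTerm x k * x) (recip-inverseʳ k) (lem (ι (suc k)) (expTerm x k * x) (recip k))
  where
  lem : ∀ i u r → i * (u * r) ≡ u + u * (i * r - 1ℚ)
  lem = solve-∀ ℚ-ring

-- Convexity of a single term, whose derivative is the preceding term. Multiplying the inequality
-- for `k` by x/(k+2) gives the next one up to a surplus, the square of x - y times a nonnegative
-- factor.
expTerm-tangent : ∀ {x y} → 0ℚ ≤ x → 0ℚ ≤ y → ∀ k →
                  expTerm y (suc k) + (x - y) * expTerm y k ≤ expTerm x (suc k)
expTerm-tangent {x} {y} _   _   zero    = ≤-reflexive (lem x y)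
  where
  lem : ∀ x y → 1ℚ * y * 1ℚ + (x - y) * 1ℚ ≡ 1ℚ * x * 1ℚ
  lem = solve-∀ ℚ-ring
expTerm-tangent {x} {y} 0≤x 0≤y (suc k) =
  ≤-cert₂ (r * x * (z - (u + (x - y) * t)) + r * ((x - y) * (x - y)) * t) ((x - y) * u) (- (r * (x - y)))
    (0≤+ (0≤* (0≤* 0≤r 0≤x) (0≤sub (expTerm-tangent 0≤x 0≤y k)))
         (0≤* (0≤* 0≤r (0≤square (x - y))) (expTerm-nonneg 0≤y k)))
    (trans (cong (_* r) (sym (ι-suc (suc k)))) (recip-inverseʳ (suc k)))
    (expTerm-step y k)
    (lem x y z u t r (ι (suc k)))
  where
  z = expTerm x (suc k)
  u = expTerm y (suc k)
  t = expTerm y k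
  r = recip (suc k)
  0≤r = 0≤recip (suc k)
  lem : ∀ x y z u t r i →
        z * x * r ≡ u * y * r + (x - y) * u + (r * x * (z - (u + (x - y) * t)) + r * ((x - y) * (x - y)) * t)
                    + (x - y) * u * ((i + 1ℚ) * r - 1ℚ) + (- (r * (x - y))) * (i * u - t * y)
  lem = solve-∀ ℚ-ring

-- Adds up the termwise tangents; the slope is the derivative of the sum of length `suc m`, hence
-- the sum of length `m`.
expSum-tangent : ∀ {x y} → 0ℚ ≤ x → 0ℚ ≤ y → ∀ m →
                 expSum y (suc m) + (x - y) * expSum y m ≤ expSum x (suc m)
expSum-tangent {x} {y} 0≤x 0≤y zero    = ≤-reflexive (lem x y)
  where
  lem : ∀ x y → 0ℚ + 1ℚ + (x - y) * 0ℚ ≡ 0ℚ + 1ℚ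
  lem = solve-∀ ℚ-ring
expSum-tangent {x} {y} 0≤x 0≤y (suc m) = subst (_≤ expSum x (suc (suc m)))
  (lem (expSum y (suc m)) (x - y) (expSum y m) (expTerm y (suc m)) (expTerm y m))
  (+-mono-≤ (expSum-tangent 0≤x 0≤y m) (expTerm-tangent 0≤x 0≤y m))
  where
  lem : ∀ S d s T t → S + d * s + (T + d * t) ≡ S + T + d * (s + t)
  lem = solve-∀ ℚ-ring

expSum-incr : ∀ {x} → 0ℚ ≤ x → ∀ {m n} → m ℕ.≤′ n → expSum x m ≤ expSum x n
expSum-incr 0≤x (ℕ.≤′-reflexive refl) = ≤-refl
expSum-incr 0≤x {n = suc n} (ℕ.≤′-step m≤n) =
  ≤-trans (expSum-incr 0≤x m≤n) (≤-cert _ (expTerm-nonneg 0≤x n) refl)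

expSum-mono : ∀ {x y} → 0ℚ ≤ x → x ≤ y → ∀ m → expSum x m ≤ expSum y m
expSum-mono 0≤x x≤y zero    = ≤-refl
expSum-mono {x} {y} 0≤x x≤y (suc m) = ≤-trans
  (≤-cert _ (0≤* (0≤sub x≤y) (expSum-nonneg 0≤x m)) refl)
  (expSum-tangent (≤-trans 0≤x x≤y) 0≤x m)

1≤expSum : ∀ {x} → 0ℚ ≤ x → ∀ m → 1ℚ ≤ expSum x (suc m)
1≤expSum 0≤x m = expSum-incr 0≤x (ℕP.≤⇒≤′ (s≤s (z≤n {m})))

1+x≤expSum : ∀ {x} → 0ℚ ≤ x → ∀ {m} → 2 ℕ.≤ m → 1ℚ + x ≤ expSum x m
1+x≤expSum {x} 0≤x {m} 2≤m = subst (_≤ expSum x m) (lem x)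
  (expSum-incr 0≤x (ℕP.≤⇒≤′ 2≤m))
  where
  lem : ∀ x → 0ℚ + 1ℚ + 1ℚ * x * 1ℚ ≡ 1ℚ + x
  lem = solve-∀ ℚ-ring

-- Each factor is a tangent step from `s` to `s + h c` and costs one term of the series, so `c`
-- factors need `suc c` terms.
∏[1+h]≤expSum : ∀ {h} → (∀ i → 0ℚ ≤ h i) → ∀ c →
                ∏< c (λ i → 1ℚ + h i) ≤ expSum (∑< c h) (suc c)
∏[1+h]≤expSum     0≤h zero    = ≤-refl
∏[1+h]≤expSum {h} 0≤h (suc c) = begin
  ∏< c (λ i → 1ℚ + h i) * (1ℚ + h c)
    ≤⟨ *-monoʳ-≤-nonNeg (1ℚ + h c) {{nonNegative (0≤+ 0≤1 (0≤h c))}} (∏[1+h]≤expSum 0≤h c) ⟩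
  expSum s (suc c) * (1ℚ + h c)
    ≤⟨ ≤-cert (expTerm s (suc c)) (expTerm-nonneg 0≤s (suc c)) (lem (expSum s (suc c)) (expTerm s (suc c)) s (h c)) ⟩
  expSum s (suc (suc c)) + (s + h c - s) * expSum s (suc c)
    ≤⟨ expSum-tangent (0≤+ 0≤s (0≤h c)) 0≤s (suc c) ⟩
  expSum (s + h c) (suc (suc c)) ∎
  where
  open ≤-Reasoning
  s = ∑< c h
  0≤s = ∑<-nonneg c 0≤h
  lem : ∀ S t s h → S + t + (s + h - s) * S ≡ S * (1ℚ + h) + t
  lem = solve-∀ ℚ-ring

-- Uses the tangent at `s + h c`, evaluated back at `s`. Here the term missing from the slope works
-- in the right direction, so the length `j` stays fixed.
expSum*∏[1-h]≤1 : ∀ {h} → (∀ i → 0ℚ ≤ h i) → (∀ i → h i ≤ 1ℚ) → ∀ c j →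
                  expSum (∑< c h) j * ∏< c (λ i → 1ℚ - h i) ≤ 1ℚ
expSum*∏[1-h]≤1 {h} 0≤h h≤1 c zero = ≤-trans (≤-reflexive (*-zeroˡ (∏< c (λ i → 1ℚ - h i)))) 0≤1
expSum*∏[1-h]≤1 {h} 0≤h h≤1 zero (suc j) = ≤-reflexive (trans (*-identityʳ (expSum 0ℚ (suc j))) (expSum0 j))
  where
  expSum0 : ∀ j → expSum 0ℚ (suc j) ≡ 1ℚ
  expSum0 zero    = refl
  expSum0 (suc j) = trans (lem (expSum 0ℚ (suc j)) (expTerm 0ℚ j) (recip j)) (expSum0 j)
    where
    lem : ∀ s t r → s + t * 0ℚ * r ≡ s
    lem = solve-∀ ℚ-ring
expSum*∏[1-h]≤1 {h} 0≤h h≤1 (suc c) (suc j) = begin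
  expSum (s + h c) (suc j) * (p * (1ℚ - h c))
    ≤⟨ ≤-cert (((expSum s (suc j) - (expSum (s + h c) (suc j) + (s - (s + h c)) * expSum (s + h c) j))
                + h c * expTerm (s + h c) j) * p)
         (0≤* (0≤+ (0≤sub (expSum-tangent 0≤s 0≤s+h j)) (0≤* (0≤h c) (expTerm-nonneg 0≤s+h j)))
              (∏<-nonneg c λ i → 0≤sub (h≤1 i)))
         (lem s (h c) p (expSum s (suc j)) (expSum (s + h c) j) (expTerm (s + h c) j)) ⟩
  expSum s (suc j) * p
    ≤⟨ expSum*∏[1-h]≤1 0≤h h≤1 c (suc j) ⟩
  1ℚ ∎
  where
  open ≤-Reasoning
  s = ∑< c h
  p = ∏< c (λ i → 1ℚ - h i)
  0≤s = ∑<-nonneg c 0≤h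
  0≤s+h = 0≤+ 0≤s (0≤h c)
  lem : ∀ s h p S z t → S * p ≡ (z + t) * (p * (1ℚ - h)) + ((S - (z + t + (s - (s + h)) * z)) + h * t) * p
  lem = solve-∀ ℚ-ring

p≤∣p∣ : ∀ p → p ≤ ∣ p ∣
p≤∣p∣ p with ≤-total 0ℚ p
... | inj₁ 0≤p = ≤-reflexive (sym (0≤p⇒∣p∣≡p 0≤p))
... | inj₂ p≤0 = ≤-trans p≤0 (0≤∣p∣ p)

-- exp y · exp (- y) = 1 in the limit.  With P i j = yⁱ/i! · (-y)ʲ/j! and
-- Q i j = y · P i j / (i + j + 1) one has P i j = Q (i-1) j - Q i (j-1), so the sum
-- of P over a square telescopes to 1 plus the values of Q on two of its sides.
module _ {y : ℚ} (0≤y : 0ℚ ≤ y) where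

  private
    a b : ℕ → ℚ
    a = expTerm y
    b = expTerm (- y)

    Q : ℕ → ℕ → ℚ
    Q i j = y * (a i * b j) * recip (i ℕ.+ j)

    P≡Q-Q : ∀ i j → a (suc i) * b (suc j) ≡ Q i (suc j) - Q (suc i) j
    P≡Q-Q i j = sym (begin
      y * (a i * b (suc j)) * recip (i ℕ.+ suc j) - y * (a (suc i) * b j) * recip (suc i ℕ.+ j)
        ≡⟨ cong (λ k → y * (a i * b (suc j)) * recip k - y * (a (suc i) * b j) * recip (suc i ℕ.+ j)) (ℕP.+-suc i j) ⟩
      y * (a i * b (suc j)) * r - y * (a (suc i) * b j) * r
        ≡⟨ lem₁ y (a i) (b (suc j)) (a (suc i)) (b j) r ⟩
      (a i * y) * (b (suc j) * r) + (b j * - y) * (a (suc i) * r)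
        ≡⟨ cong₂ (λ u v → u * (b (suc j) * r) + v * (a (suc i) * r)) (expTerm-step y i) (expTerm-step (- y) j) ⟨
      (ι (suc i) * a (suc i)) * (b (suc j) * r) + (ι (suc j) * b (suc j)) * (a (suc i) * r)
        ≡⟨ lem₂ (ι (suc i)) (ι (suc j)) (a (suc i)) (b (suc j)) r ⟩
      a (suc i) * b (suc j) * ((ι (suc i) + ι (suc j)) * r)
        ≡⟨ cong (λ z → a (suc i) * b (suc j) * (z * r)) (trans (sym (ι-+ (suc i) (suc j))) (cong (λ k → ι (suc k)) (ℕP.+-suc i j))) ⟩
      a (suc i) * b (suc j) * (ι (suc (suc (i ℕ.+ j))) * r)
        ≡⟨ cong (a (suc i) * b (suc j) *_) (recip-inverseʳ (suc (i ℕ.+ j))) ⟩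
      a (suc i) * b (suc j) * 1ℚ
        ≡⟨ *-identityʳ _ ⟩
      a (suc i) * b (suc j) ∎)
      where
      open ≡-Reasoning
      r = recip (suc (i ℕ.+ j))
      lem₁ : ∀ y ai bj′ ai′ bj r → y * (ai * bj′) * r - y * (ai′ * bj) * r ≡ (ai * y) * (bj′ * r) + (bj * - y) * (ai′ * r)
      lem₁ = solve-∀ ℚ-ring
      lem₂ : ∀ i j u v r → (i * u) * (v * r) + (j * v) * (u * r) ≡ u * v * ((i + j) * r)
      lem₂ = solve-∀ ℚ-ring

    -- The corner `a 0 * b 0` is the `1ℚ`; every other entry of this row is a single `- Q 0 j`, as
    -- `Q` has no earlier row.
    row₀ : ∀ n → a 0 * ∑< (suc n) b ≡ 1ℚ - ∑< n (Q 0)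
    row₀ zero    = refl
    row₀ (suc n) = trans (lem₁ (∑< (suc n) b) (b n) y (recip n))
      (trans (cong (λ z → z - Q 0 n) (row₀ n)) (lem₂ (∑< n (Q 0)) (Q 0 n)))
      where
      lem₁ : ∀ s b y r → 1ℚ * (s + b * - y * r) ≡ 1ℚ * s - y * (1ℚ * b) * r
      lem₁ = solve-∀ ℚ-ring
      lem₂ : ∀ s q → 1ℚ - s - q ≡ 1ℚ - (s + q)
      lem₂ = solve-∀ ℚ-ring

    row : ∀ i n → a (suc i) * ∑< (suc n) b ≡ ∑< (suc n) (Q i) - ∑< n (Q (suc i))
    row i zero    = trans (lem y (a i) (recip i)) (cong (λ k → 0ℚ + y * (a i * 1ℚ) * recip k - 0ℚ) (sym (ℕP.+-identityʳ i)))
      where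
      lem : ∀ y a r → a * y * r * (0ℚ + 1ℚ) ≡ 0ℚ + y * (a * 1ℚ) * r - 0ℚ
      lem = solve-∀ ℚ-ring
    row i (suc n) = trans (*-distribˡ-+ (a (suc i)) (∑< (suc n) b) (b (suc n)))
      (trans (cong₂ _+_ (row i n) (P≡Q-Q i n))
             (sym (interchange (∑< (suc n) (Q i)) (Q i (suc n)) (∑< n (Q (suc i))) (Q (suc i) n))))

    rectangle : ∀ r n → ∑< (suc r) a * ∑< (suc n) b ≡ 1ℚ + ∑< r (λ i → Q i n) - ∑< n (Q r)
    rectangle zero    n = trans (cong (_* ∑< (suc n) b) (+-identityˡ 1ℚ)) (row₀ n)
    rectangle (suc r) n = trans (*-distribʳ-+ (∑< (suc n) b) (∑< (suc r) a) (a (suc r)))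
      (trans (cong₂ _+_ (rectangle r n) (row r n))
             (lem (∑< r (λ i → Q i n)) (∑< n (Q r)) (Q r n) (∑< n (Q (suc r)))))
      where
      lem : ∀ s t q u → 1ℚ + s - t + (t + q - u) ≡ 1ℚ + (s + q) - u
      lem = solve-∀ ℚ-ring

    ∣b∣≤a : ∀ j → ∣ b j ∣ ≤ a j
    ∣b∣≤a zero    = ≤-refl
    ∣b∣≤a (suc j) = begin
      ∣ b j * - y * recip j ∣      ≡⟨ ∣p*q∣≡∣p∣*∣q∣ (b j * - y) (recip j) ⟩
      ∣ b j * - y ∣ * ∣ recip j ∣  ≡⟨ cong₂ _*_ (∣p*q∣≡∣p∣*∣q∣ (b j) (- y)) (0≤p⇒∣p∣≡p (0≤recip j)) ⟩
      ∣ b j ∣ * ∣ - y ∣ * recip j  ≡⟨ cong (λ z → ∣ b j ∣ * z * recip j) (trans (∣-p∣≡∣p∣ y) (0≤p⇒∣p∣≡p 0≤y)) ⟩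
      ∣ b j ∣ * y * recip j        ≤⟨ *-monoʳ-≤-nonNeg (recip j) {{nonNegative (0≤recip j)}}
                                       (*-monoʳ-≤-nonNeg y {{nonNegative 0≤y}} (∣b∣≤a j)) ⟩
      a j * y * recip j            ∎
      where open ≤-Reasoning

    ∣Q∣≤ : ∀ i j {k} → k ℕ.≤ i ℕ.+ j → ∣ Q i j ∣ ≤ y * (a i * a j) * recip k
    ∣Q∣≤ i j {k} k≤i+j = begin
      ∣ y * (a i * b j) * recip (i ℕ.+ j) ∣
        ≡⟨ ∣p*q∣≡∣p∣*∣q∣ (y * (a i * b j)) (recip (i ℕ.+ j)) ⟩
      ∣ y * (a i * b j) ∣ * ∣ recip (i ℕ.+ j) ∣
        ≡⟨ cong₂ _*_ (trans (∣p*q∣≡∣p∣*∣q∣ y (a i * b j)) (cong₂ _*_ (0≤p⇒∣p∣≡p 0≤y) (∣p*q∣≡∣p∣*∣q∣ (a i) (b j))))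
                     (0≤p⇒∣p∣≡p (0≤recip (i ℕ.+ j))) ⟩
      y * (∣ a i ∣ * ∣ b j ∣) * recip (i ℕ.+ j)
        ≡⟨ cong (λ z → y * (z * ∣ b j ∣) * recip (i ℕ.+ j)) (0≤p⇒∣p∣≡p (0≤a i)) ⟩
      y * (a i * ∣ b j ∣) * recip (i ℕ.+ j)
        ≤⟨ *-mono-≤₀ (0≤* 0≤y (0≤* (0≤a i) (0≤a j))) (0≤recip (i ℕ.+ j))
             (*-monoˡ-≤-nonNeg y {{nonNegative 0≤y}} (*-monoˡ-≤-nonNeg (a i) {{nonNegative (0≤a i)}} (∣b∣≤a j)))
             (recip-anti k≤i+j) ⟩
      y * (a i * a j) * recip k ∎
      where
      open ≤-Reasoning
      0≤a = expTerm-nonneg 0≤y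

    ∣∑Q∣≤ : ∀ n {f} k → (∀ i → ∣ f i ∣ ≤ a (suc k) * a i) → ∣ ∑< n f ∣ ≤ a (suc k) * expSum y n
    ∣∑Q∣≤ zero        k h = ≤-reflexive (sym (*-zeroʳ (a (suc k))))
    ∣∑Q∣≤ (suc n) {f} k h = begin
      ∣ ∑< n f + f n ∣                              ≤⟨ ∣p+q∣≤∣p∣+∣q∣ (∑< n f) (f n) ⟩
      ∣ ∑< n f ∣ + ∣ f n ∣                          ≤⟨ +-mono-≤ (∣∑Q∣≤ n k h) (h n) ⟩
      a (suc k) * expSum y n + a (suc k) * a n      ≡⟨ *-distribˡ-+ (a (suc k)) (expSum y n) (a n) ⟨
      a (suc k) * (expSum y n + a n)                ∎
      where open ≤-Reasoning

  -- On both remaining sides one index is n, so the reciprocal is at most 1/(n+1), and y · yⁿ/n! ·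
  -- 1/(n+1) is the first omitted term of exp y.
  expSum-neg : ∀ n → ∣ expSum (- y) (suc n) * expSum y (suc n) - 1ℚ ∣ ≤
                     expTerm y (suc n) * expSum y n + expTerm y (suc n) * expSum y n
  expSum-neg n = begin
    ∣ expSum (- y) (suc n) * expSum y (suc n) - 1ℚ ∣
      ≡⟨ cong (λ z → ∣ z - 1ℚ ∣) (trans (*-comm (expSum (- y) (suc n)) (expSum y (suc n))) (rectangle n n)) ⟩
    ∣ 1ℚ + ∑< n (λ i → Q i n) - ∑< n (Q n) - 1ℚ ∣
      ≡⟨ cong ∣_∣ (lem₁ (∑< n (λ i → Q i n)) (∑< n (Q n))) ⟩
    ∣ ∑< n (λ i → Q i n) - ∑< n (Q n) ∣
      ≤⟨ ∣p-q∣≤∣p∣+∣q∣ (∑< n (λ i → Q i n)) (∑< n (Q n)) ⟩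
    ∣ ∑< n (λ i → Q i n) ∣ + ∣ ∑< n (Q n) ∣
      ≤⟨ +-mono-≤
           (∣∑Q∣≤ n n λ i → subst (∣ Q i n ∣ ≤_) (lem₂ y (a i) (a n) (recip n)) (∣Q∣≤ i n (ℕP.m≤n+m n i)))
           (∣∑Q∣≤ n n λ i → subst (∣ Q n i ∣ ≤_) (lem₃ y (a i) (a n) (recip n)) (∣Q∣≤ n i (ℕP.m≤m+n n i))) ⟩
    a (suc n) * expSum y n + a (suc n) * expSum y n ∎
    where
    open ≤-Reasoning
    lem₁ : ∀ s t → 1ℚ + s - t - 1ℚ ≡ s - t
    lem₁ = solve-∀ ℚ-ring
    lem₂ : ∀ y i n r → y * (i * n) * r ≡ n * y * r * i
    lem₂ = solve-∀ ℚ-ring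
    lem₃ : ∀ y i n r → y * (n * i) * r ≡ n * y * r * i
    lem₃ = solve-∀ ℚ-ring

-- Since 1 + 1/(m+1+i) and 1 - 1/(m+1+i) are ratios of consecutive integers, the
-- products of these numbers telescope.

module _ (m : ℕ) where

  private
    h : ℕ → ℚ
    h i = recip (m ℕ.+ i)

    h≤1 : ∀ i → h i ≤ 1ℚ
    h≤1 i = recip-anti {0} {m ℕ.+ i} z≤n

  ∏[1+recip] : ∀ c → ι (suc m) * ∏< c (λ i → 1ℚ + h i) ≡ ι (suc (m ℕ.+ c))
  ∏[1+recip] zero    = trans (*-identityʳ (ι (suc m))) (cong (λ k → ι (suc k)) (sym (ℕP.+-identityʳ m)))
  ∏[1+recip] (suc c) = begin
    ι (suc m) * (∏< c (λ i → 1ℚ + h i) * (1ℚ + h c))   ≡⟨ *-assoc (ι (suc m)) (∏< c (λ i → 1ℚ + h i)) (1ℚ + h c) ⟨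
    ι (suc m) * ∏< c (λ i → 1ℚ + h i) * (1ℚ + h c)     ≡⟨ cong (_* (1ℚ + h c)) (∏[1+recip] c) ⟩
    ι (suc (m ℕ.+ c)) * (1ℚ + h c)                     ≡⟨ ≡-cert₁ 1ℚ (recip-inverseʳ (m ℕ.+ c)) (lem (ι (suc (m ℕ.+ c))) (h c)) ⟩
    ι (suc (m ℕ.+ c)) + 1ℚ                             ≡⟨ ι-suc (suc (m ℕ.+ c)) ⟨
    ι (suc (suc (m ℕ.+ c)))                            ≡⟨ cong (λ k → ι (suc k)) (ℕP.+-suc m c) ⟨
    ι (suc (m ℕ.+ suc c))                              ∎
    where
    open ≡-Reasoning
    lem : ∀ i r → i * (1ℚ + r) ≡ i + 1ℚ + 1ℚ * (i * r - 1ℚ)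
    lem = solve-∀ ℚ-ring

  ∏[1-recip] : ∀ c → ∏< c (λ i → 1ℚ - h i) * ι (m ℕ.+ c) ≡ ι m
  ∏[1-recip] zero    = trans (*-identityˡ (ι (m ℕ.+ 0))) (cong ι (ℕP.+-identityʳ m))
  ∏[1-recip] (suc c) = begin
    p * (1ℚ - h c) * ι (m ℕ.+ suc c)          ≡⟨ cong (λ k → p * (1ℚ - h c) * ι k) (ℕP.+-suc m c) ⟩
    p * (1ℚ - h c) * ι (suc (m ℕ.+ c))        ≡⟨ ≡-cert₁ (- p) (recip-inverseʳ (m ℕ.+ c)) (lem p (h c) (ι (suc (m ℕ.+ c)))) ⟩
    p * (ι (suc (m ℕ.+ c)) - 1ℚ)              ≡⟨ cong (λ z → p * (z - 1ℚ)) (ι-suc (m ℕ.+ c)) ⟩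
    p * (ι (m ℕ.+ c) + 1ℚ - 1ℚ)               ≡⟨ cong (p *_) (add-sub (ι (m ℕ.+ c)) 1ℚ) ⟩
    p * ι (m ℕ.+ c)                           ≡⟨ ∏[1-recip] c ⟩
    ι m                                       ∎
    where
    open ≡-Reasoning
    p = ∏< c (λ i → 1ℚ - h i)
    lem : ∀ p r i → p * (1ℚ - r) * i ≡ p * (i - 1ℚ) + (- p) * (i * r - 1ℚ)
    lem = solve-∀ ℚ-ring

  -- For c = (n - 1) m the sum of the `h i` is `lnSum n m`. This bound and the next enclose the
  -- exponential of it between (nm + 1)/(m + 1) and n.
  ι≤expSum-recip : ∀ c → ι (suc (m ℕ.+ c)) ≤ ι (suc m) * expSum (∑< c h) (suc c)
  ι≤expSum-recip c = subst (_≤ ι (suc m) * expSum (∑< c h) (suc c)) (∏[1+recip] c)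
    (*-monoˡ-≤-nonNeg (ι (suc m)) {{nonNegative (0≤ι (suc m))}} (∏[1+h]≤expSum (λ i → 0≤recip (m ℕ.+ i)) c))

  expSum-recip≤ι : ∀ c j → expSum (∑< c h) j * ι m ≤ ι (m ℕ.+ c)
  expSum-recip≤ι c j = begin
    expSum (∑< c h) j * ι m
      ≡⟨ cong (expSum (∑< c h) j *_) (∏[1-recip] c) ⟨
    expSum (∑< c h) j * (∏< c (λ i → 1ℚ - h i) * ι (m ℕ.+ c))
      ≡⟨ *-assoc (expSum (∑< c h) j) (∏< c (λ i → 1ℚ - h i)) (ι (m ℕ.+ c)) ⟨
    expSum (∑< c h) j * ∏< c (λ i → 1ℚ - h i) * ι (m ℕ.+ c)
      ≤⟨ *-monoʳ-≤-nonNeg (ι (m ℕ.+ c)) {{nonNegative (0≤ι (m ℕ.+ c))}}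
           (expSum*∏[1-h]≤1 (λ i → 0≤recip (m ℕ.+ i)) h≤1 c j) ⟩
    1ℚ * ι (m ℕ.+ c)
      ≡⟨ *-identityˡ (ι (m ℕ.+ c)) ⟩
    ι (m ℕ.+ c) ∎
    where open ≤-Reasoning

-- The identity exp (ln n) = n for approximations

lnSum-nonneg : ∀ n m → 0ℚ ≤ lnSum n m
lnSum-nonneg n m = ∑<-nonneg ((n ∸ 1) ℕ.* m) (λ i → 0≤recip (m ℕ.+ i))

-- There is no error term because a right-endpoint sum of 1/t stays below ln n.
expSum-lnSum≤ : ∀ n k j → expSum (lnSum (suc n) (suc k)) j ≤ ι (suc n)
expSum-lnSum≤ n k j = begin
  S                          ≡⟨ *-identityʳ S ⟨
  S * 1ℚ                     ≡⟨ cong (S *_) (recip-inverseʳ k) ⟨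
  S * (ι (suc k) * recip k)  ≡⟨ *-assoc S (ι (suc k)) (recip k) ⟨
  S * ι (suc k) * recip k    ≤⟨ *-monoʳ-≤-nonNeg (recip k) {{nonNegative (0≤recip k)}} (expSum-recip≤ι (suc k) (n ℕ.* suc k) j) ⟩
  ι (suc n ℕ.* suc k) * recip k
                             ≡⟨ cong (_* recip k) (ι-* (suc n) (suc k)) ⟩
  ι (suc n) * ι (suc k) * recip k
                             ≡⟨ *-assoc (ι (suc n)) (ι (suc k)) (recip k) ⟩
  ι (suc n) * (ι (suc k) * recip k)
                             ≡⟨ cong (ι (suc n) *_) (recip-inverseʳ k) ⟩
  ι (suc n) * 1ℚ             ≡⟨ *-identityʳ (ι (suc n)) ⟩
  ι (suc n)                  ∎
  where
  open ≤-Reasoning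
  S = expSum (lnSum (suc n) (suc k)) j

≤expSum-lnSum : ∀ n m → ι (suc n) - ι n * recip m ≤ expSum (lnSum (suc n) m) (suc (n ℕ.* m))
≤expSum-lnSum n m = subst (λ z → z - ι n * r ≤ S) (sym (ι-suc n))
  (≤-cert₂ ((ι (suc m) * S - ι (suc (m ℕ.+ n ℕ.* m))) * r) (ι n + 1ℚ - S) r
    (0≤* (0≤sub (ι≤expSum-recip m (n ℕ.* m))) (0≤recip m))
    (recip-inverseʳ m) index
    (lem₁ S (ι n) r (ι (suc m)) (ι (suc (m ℕ.+ n ℕ.* m)))))
  where
  S = expSum (lnSum (suc n) m) (suc (n ℕ.* m))
  r = recip m
  lem₁ : ∀ S n r m k → S ≡ (n + 1ℚ) - n * r + (m * S - k) * r + (n + 1ℚ - S) * (m * r - 1ℚ) + r * (k - ((n + 1ℚ) * m - n))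
  lem₁ = solve-∀ ℚ-ring
  lem₂ : ∀ n m → m + n * m + 1ℚ ≡ (n + 1ℚ) * (m + 1ℚ) - n
  lem₂ = solve-∀ ℚ-ring
  index : ι (suc (m ℕ.+ n ℕ.* m)) ≡ (ι n + 1ℚ) * ι (suc m) - ι n
  index = begin
    ι (suc (m ℕ.+ n ℕ.* m))           ≡⟨ ι-suc (m ℕ.+ n ℕ.* m) ⟩
    ι (m ℕ.+ n ℕ.* m) + 1ℚ            ≡⟨ cong (_+ 1ℚ) (trans (ι-+ m (n ℕ.* m)) (cong (ι m +_) (ι-* n m))) ⟩
    ι m + ι n * ι m + 1ℚ              ≡⟨ lem₂ (ι n) (ι m) ⟩
    (ι n + 1ℚ) * (ι m + 1ℚ) - ι n     ≡⟨ cong (λ z → (ι n + 1ℚ) * z - ι n) (ι-suc m) ⟨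
    (ι n + 1ℚ) * ι (suc m) - ι n      ∎
    where open ≡-Reasoning

-- Eventual statements and the choice of constants

Eventually : (ℕ → Set) → Set
Eventually P = ∃[ N ] ∀ n → n ≥ N → P n

module _ {P Q : ℕ → Set} where

  map-ev : (∀ n → P n → Q n) → Eventually P → Eventually Q
  map-ev f (N , h) = N , λ n n≥N → f n (h n n≥N)

  infixr 4 _,ᵉ_

  _,ᵉ_ : Eventually P → Eventually Q → Eventually (λ n → P n × Q n)
  (N , h) ,ᵉ (M , g) = N ℕ.⊔ M , λ n n≥ →
    h n (ℕP.≤-trans (ℕP.m≤m⊔n N M) n≥) , g n (ℕP.≤-trans (ℕP.m≤n⊔m N M) n≥)

shift-ev : ∀ {P : ℕ → Set} → Eventually (λ n → P (suc n)) → Eventually P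
shift-ev {P} (N , h) = suc N , λ { (suc n) (s≤s n≥N) → h n n≥N }

unshift-ev : ∀ {P : ℕ → Set} → Eventually P → Eventually (λ n → P (suc n))
unshift-ev (N , h) = N , λ n n≥N → h (suc n) (ℕP.m≤n⇒m≤1+n n≥N)

-- A positive integer above `D` replaces `D` in the quotient ε/D, so `D` may have any sign.
shrink : ∀ {ε} → 0ℚ < ε → ∀ D → ∃[ η ] 0ℚ < η × D * η ≤ ε
shrink {ε} 0<ε D = let c , D≤c = archimedean D in ε * recip c , 0<* 0<ε (0<recip c) , (begin
  D * (ε * recip c)          ≤⟨ *-monoʳ-≤-nonNeg (ε * recip c) {{nonNegative (0≤* (<⇒≤ 0<ε) (0≤recip c))}}
                                  (≤-trans D≤c (ι-mono (ℕP.n≤1+n c))) ⟩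
  ι (suc c) * (ε * recip c)  ≡⟨ swap-front (ι (suc c)) ε (recip c) ⟩
  ε * (ι (suc c) * recip c)  ≡⟨ trans (cong (ε *_) (recip-inverseʳ c)) (*-identityʳ ε) ⟩
  ε                          ∎)
  where open ≤-Reasoning

exceed : ∀ {c} → 0ℚ < c → ∀ d → Eventually (λ n → d ≤ c * ι n)
exceed {c} 0<c d = let j , rj≤c = recip-small 0<c
                       e , d≤e  = archimedean d
                   in suc j ℕ.* e , λ n n≥ → begin
  d                              ≤⟨ d≤e ⟩
  ι e                            ≡⟨ trans (sym (*-identityˡ (ι e))) (cong (_* ι e) (sym (trans (*-comm (recip j) (ι (suc j))) (recip-inverseʳ j)))) ⟩
  recip j * ι (suc j) * ι e      ≡⟨ trans (*-assoc (recip j) (ι (suc j)) (ι e)) (cong (recip j *_) (sym (ι-* (suc j) e))) ⟩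
  recip j * ι (suc j ℕ.* e)      ≤⟨ *-mono-≤₀ (<⇒≤ 0<c) (0≤ι (suc j ℕ.* e)) rj≤c (ι-mono n≥) ⟩
  c * ι n                        ∎
  where open ≤-Reasoning

-- Uniform estimates for the exponential on [0, K]

expTerm-mono : ∀ {x y} → 0ℚ ≤ x → x ≤ y → ∀ k → expTerm x k ≤ expTerm y k
expTerm-mono 0≤x x≤y zero    = ≤-refl
expTerm-mono {x} {y} 0≤x x≤y (suc k) = *-monoʳ-≤-nonNeg (recip k) {{nonNegative (0≤recip k)}}
  (*-mono-≤₀ (expTerm-nonneg (≤-trans 0≤x x≤y) k) 0≤x (expTerm-mono 0≤x x≤y k) x≤y)

module _ {K : ℚ} (0≤K : 0ℚ ≤ K) where

  private
    M = proj₁ (archimedean (K + K))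
    2K≤M = proj₂ (archimedean (K + K))

  expTerm-small : ∀ {ε} → 0ℚ < ε → Eventually (λ n → expTerm K n ≤ ε)
  expTerm-small = t-small 0≤K M 2K≤M

  -- Uniformity in `x` is essential: the argument of the exponential is itself an approximation that
  -- moves with the index.
  expSum-tail-small : ∀ {ε} → 0ℚ < ε →
    Eventually (λ n → ∀ m → n ℕ.≤ m → ∀ {x} → 0ℚ ≤ x → x ≤ K → expSum x m ≤ expSum x n + ε)
  expSum-tail-small {ε} 0<ε = map-ev bound ((M , λ _ n≥M → n≥M) ,ᵉ expTerm-small (0<ε½ 0<ε))
    where
    open ≤-Reasoning
    bound : ∀ n → n ≥ M × expTerm K n ≤ ε * ½ →
            ∀ m → n ℕ.≤ m → ∀ {x} → 0ℚ ≤ x → x ≤ K → expSum x m ≤ expSum x n + ε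
    bound n (n≥M , t≤) m n≤m {x} 0≤x x≤K = begin
      expSum x m                          ≡⟨ trans (+-comm (expSum x n) (expSum x m - expSum x n)) (sub-add (expSum x m) (expSum x n)) ⟨
      expSum x n + (expSum x m - expSum x n)
                                          ≤⟨ +-monoʳ-≤ (expSum x n) (begin
        expSum x m - expSum x n             ≤⟨ p≤∣p∣ _ ⟩
        ∣ expSum x m - expSum x n ∣         ≤⟨ expSum-tail 0≤K M 2K≤M (subst (_≤ K) (sym (0≤p⇒∣p∣≡p 0≤x)) x≤K) (ℕP.≤⇒≤′ n≤m) ⟩
        expSum K m - expSum K n             ≤⟨ S-tail 0≤K M 2K≤M n≥M n≤m ⟩
        expTerm K n + expTerm K n           ≤⟨ +-mono-≤ t≤ t≤ ⟩
        ε * ½ + ε * ½                       ≡⟨ halves ε ⟩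
        ε                                   ∎) ⟩
      expSum x n + ε                      ∎

  expSum-bounded : ∃[ D ] 0ℚ ≤ D × (∀ m → expSum K m ≤ D)
  expSum-bounded = let N , h = expSum-tail-small (positive⁻¹ 1ℚ) in
    expSum K N + 1ℚ ,
    0≤+ (expSum-nonneg 0≤K N) 0≤1 ,
    λ m → ≤-trans (expSum-incr 0≤K (ℕP.≤⇒≤′ (ℕP.m≤n⊔m N m))) (h N ℕP.≤-refl (N ℕ.⊔ m) (ℕP.m≤m⊔n N m) 0≤K ≤-refl)

  -- The error in `expSum-neg` is a first omitted term, uniformly small on [0, K], times a bounded
  -- sum.
  expSum-neg-small : ∀ {ε} → 0ℚ < ε →
    Eventually (λ n → ∀ {y} → 0ℚ ≤ y → y ≤ K → ∣ expSum (- y) n * expSum y n - 1ℚ ∣ ≤ ε)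
  expSum-neg-small {ε} 0<ε =
    let D , 0≤D , S≤D = expSum-bounded
        η , 0<η , Dη≤ε = shrink 0<ε (D + D)
    in shift-ev (map-ev (λ n t≤η {y} 0≤y y≤K → begin
      ∣ expSum (- y) (suc n) * expSum y (suc n) - 1ℚ ∣
        ≤⟨ expSum-neg 0≤y n ⟩
      expTerm y (suc n) * expSum y n + expTerm y (suc n) * expSum y n
        ≤⟨ +-mono-≤ (tS≤ n t≤η 0≤y y≤K S≤D) (tS≤ n t≤η 0≤y y≤K S≤D) ⟩
      η * D + η * D
        ≡⟨ lem η D ⟩
      (D + D) * η
        ≤⟨ Dη≤ε ⟩
      ε ∎) (unshift-ev (expTerm-small 0<η)))
    where
    open ≤-Reasoning
    lem : ∀ η D → η * D + η * D ≡ (D + D) * η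
    lem = solve-∀ ℚ-ring
    tS≤ : ∀ n {η D} → expTerm K (suc n) ≤ η → ∀ {y} → 0ℚ ≤ y → y ≤ K → (∀ m → expSum K m ≤ D) →
          expTerm y (suc n) * expSum y n ≤ η * D
    tS≤ n t≤η 0≤y y≤K S≤D = *-mono-≤₀
      (≤-trans (expTerm-nonneg 0≤K (suc n)) t≤η) (expSum-nonneg 0≤y n)
      (≤-trans (expTerm-mono 0≤y y≤K (suc n)) t≤η) (≤-trans (expSum-mono 0≤y y≤K n) (S≤D n))

-- The logarithm

-- A crude consequence of 1 + x ≤ exp x. It confines the exponents belonging to a fixed n to one
-- interval [0, K], where the uniform estimates apply.
lnSum≤ι : ∀ n k → lnSum (suc n) (suc k) ≤ ι (suc n)
lnSum≤ι n k = begin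
  L                ≡⟨ +-identityˡ L ⟨
  0ℚ + L           ≤⟨ +-monoˡ-≤ L 0≤1 ⟩
  1ℚ + L           ≤⟨ 1+x≤expSum (lnSum-nonneg (suc n) (suc k)) ℕP.≤-refl ⟩
  expSum L 2       ≤⟨ expSum-lnSum≤ n k 2 ⟩
  ι (suc n)        ∎
  where
  open ≤-Reasoning
  L = lnSum (suc n) (suc k)

-- Half of ε covers the discretization error of `≤expSum-lnSum`, half the cut of its long series to
-- `k` terms. The series has at least `k` terms because the integer `suc (suc n)` is at least 2.
ι-small≤expSum-lnSum : ∀ n {ε} → 0ℚ < ε →
  Eventually (λ k → ι (suc (suc n)) - ε ≤ expSum (lnSum (suc (suc n)) (suc k)) k)
ι-small≤expSum-lnSum n {ε} 0<ε =
  let η , 0<η , nη≤ = shrink (0<ε½ 0<ε) (ι (suc n))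
      j , rj≤η = recip-small 0<η
  in map-ev (bound nη≤ rj≤η) ((j , λ _ k≥j → k≥j) ,ᵉ expSum-tail-small (0≤ι (suc (suc n))) (0<ε½ 0<ε))
  where
  N = ι (suc (suc n))
  bound : ∀ {η j} → ι (suc n) * η ≤ ε * ½ → recip j ≤ η → ∀ k → k ≥ j × (∀ m → k ℕ.≤ m →
          ∀ {x} → 0ℚ ≤ x → x ≤ N → expSum x m ≤ expSum x k + ε * ½) → N - ε ≤ expSum (lnSum (suc (suc n)) (suc k)) k
  bound {η} {j} nη≤ rj≤η k (k≥j , tail) = begin
    N - ε                                ≡⟨ cong (λ z → N - z) (halves ε) ⟨
    N - (ε * ½ + ε * ½)                  ≡⟨ lem N (ε * ½) ⟩
    N - ε * ½ - ε * ½                    ≤⟨ +-monoˡ-≤ (- (ε * ½)) (+-monoʳ-≤ N (neg-antimono-≤ nr≤)) ⟩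
    N - ι (suc n) * recip (suc k) - ε * ½  ≤⟨ ≤+⇒-≤ (begin
      N - ι (suc n) * recip (suc k)        ≤⟨ ≤expSum-lnSum (suc n) (suc k) ⟩
      expSum L (suc (suc n ℕ.* suc k))     ≤⟨ tail _ (ℕP.≤-trans (ℕP.≤-trans (ℕP.n≤1+n k) (ℕP.m≤m+n (suc k) (n ℕ.* suc k))) (ℕP.n≤1+n _))
                                                (lnSum-nonneg (suc (suc n)) (suc k)) (lnSum≤ι (suc n) k) ⟩
      expSum L k + ε * ½                   ∎) ⟩
    expSum L k                           ∎
    where
    open ≤-Reasoning
    L = lnSum (suc (suc n)) (suc k)
    nr≤ : ι (suc n) * recip (suc k) ≤ ε * ½
    nr≤ = ≤-trans (*-monoˡ-≤-nonNeg (ι (suc n)) {{nonNegative (0≤ι (suc n))}}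
            (≤-trans (recip-anti (ℕP.m≤n⇒m≤1+n k≥j)) rj≤η)) nη≤
    lem : ∀ n e → n - (e + e) ≡ n - e - e
    lem = solve-∀ ℚ-ring

-- If the logarithm stayed below `B`, its exponential would stay below `D`; but that exponential
-- exceeds n/2, since 1/(k+2) is at most 1/2.
lnSum-unbounded : ∀ {B} → 0ℚ ≤ B → Eventually (λ n → ∀ k → B ≤ lnSum n (suc k))
lnSum-unbounded {B} 0≤B =
  let D , _ , S≤D = expSum-bounded 0≤B
  in shift-ev (map-ev (λ n D≤ k → bound S≤D n D≤ k) (exceed (positive⁻¹ ½) D))
  where
  bound : ∀ {D} → (∀ m → expSum B m ≤ D) → ∀ n → D ≤ ½ * ι n → ∀ k → B ≤ lnSum (suc n) (suc k)
  bound {D} S≤D n D≤ k with ≤-total B (lnSum (suc n) (suc k))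
  ... | inj₁ B≤L = B≤L
  ... | inj₂ L≤B = contradiction (begin-strict
    D                                     ≤⟨ D≤ ⟩
    ½ * ι n                               ≡⟨ lem (ι n) ⟩
    ι n - ι n * ½                         ≤⟨ +-monoʳ-≤ (ι n) (neg-antimono-≤ (*-monoˡ-≤-nonNeg (ι n) {{nonNegative (0≤ι n)}}
                                               (recip-anti (s≤s (z≤n {k}))))) ⟩
    ι n - ι n * recip (suc k)             <⟨ +-monoˡ-< (- (ι n * recip (suc k))) n<1+n ⟩
    ι (suc n) - ι n * recip (suc k)       ≤⟨ ≤expSum-lnSum n (suc k) ⟩
    expSum L (suc (n ℕ.* suc k))          ≤⟨ expSum-mono (lnSum-nonneg (suc n) (suc k)) L≤B (suc (n ℕ.* suc k)) ⟩
    expSum B (suc (n ℕ.* suc k))          ≤⟨ S≤D (suc (n ℕ.* suc k)) ⟩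
    D                                     ∎) (<-irrefl refl)
    where
    open ≤-Reasoning
    L = lnSum (suc n) (suc k)
    lem : ∀ n → ½ * n ≡ n - n * ½
    lem = solve-∀ ℚ-ring
    n<1+n : ι n < ι (suc n)
    n<1+n = subst₂ _<_ (+-identityʳ (ι n)) (sym (ι-suc n)) (+-monoʳ-< (ι n) (positive⁻¹ 1ℚ))

-- Powers

pow : ℚ → ℕ → ℚ
pow x n = ∏< n (λ _ → x)

∑<-const : ∀ n x → ∑< n (λ _ → x) ≡ ι n * x
∑<-const zero    x = sym (*-zeroˡ x)
∑<-const (suc n) x = trans (cong (_+ x) (∑<-const n x)) (trans (suc-mult (ι n) x) (cong (_* x) (sym (ι-suc n))))

pow-* : ∀ x y n → pow (x * y) n ≡ pow x n * pow y n
pow-* x y zero    = refl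
pow-* x y (suc n) = trans (cong (_* (x * y)) (pow-* x y n)) (lem (pow x n) (pow y n) x y)
  where
  lem : ∀ p q x y → p * q * (x * y) ≡ p * x * (q * y)
  lem = solve-∀ ℚ-ring

pow-nonneg : ∀ {x} → 0ℚ ≤ x → ∀ n → 0ℚ ≤ pow x n
pow-nonneg 0≤x n = ∏<-nonneg n (λ _ → 0≤x)

pow≤1 : ∀ {x} → 0ℚ ≤ x → x ≤ 1ℚ → ∀ n → pow x n ≤ 1ℚ
pow≤1 0≤x x≤1 zero    = ≤-refl
pow≤1 0≤x x≤1 (suc n) = *-mono-≤₀ 0≤1 0≤x (pow≤1 0≤x x≤1 n) x≤1

bernoulli : ∀ {x} → 0ℚ ≤ x → x ≤ 1ℚ → ∀ n → 1ℚ - ι n * x ≤ pow (1ℚ - x) n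
bernoulli {x} 0≤x x≤1 zero    = ≤-reflexive (lem x)
  where
  lem : ∀ x → 1ℚ - 0ℚ * x ≡ 1ℚ
  lem = solve-∀ ℚ-ring
bernoulli {x} 0≤x x≤1 (suc n) = subst (λ i → 1ℚ - i * x ≤ p * (1ℚ - x)) (sym (ι-suc n))
  (≤-cert ((p - (1ℚ - ι n * x)) * (1ℚ - x) + ι n * (x * x))
    (0≤+ (0≤* (0≤sub (bernoulli 0≤x x≤1 n)) (0≤sub x≤1)) (0≤* (0≤ι n) (0≤square x)))
    (lem p (ι n) x))
  where
  p = pow (1ℚ - x) n
  lem : ∀ p n x → p * (1ℚ - x) ≡ 1ℚ - (n + 1ℚ) * x + ((p - (1ℚ - n * x)) * (1ℚ - x) + n * (x * x))
  lem = solve-∀ ℚ-ring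

-- Since (1 - x)(1 + (n+1)x) = 1 + nx - (n+1)x², the product decreases with n.
pow*[1+nx]≤1 : ∀ {x} → 0ℚ ≤ x → x ≤ 1ℚ → ∀ n → pow (1ℚ - x) n * (1ℚ + ι n * x) ≤ 1ℚ
pow*[1+nx]≤1 {x} 0≤x x≤1 zero    = ≤-reflexive (lem x)
  where
  lem : ∀ x → 1ℚ * (1ℚ + 0ℚ * x) ≡ 1ℚ
  lem = solve-∀ ℚ-ring
pow*[1+nx]≤1 {x} 0≤x x≤1 (suc n) = subst (λ i → p * (1ℚ - x) * (1ℚ + i * x) ≤ 1ℚ) (sym (ι-suc n))
  (≤-trans
    (≤-cert (p * (x * x) * (ι n + 1ℚ))
      (0≤* (0≤* (pow-nonneg (0≤sub x≤1) n) (0≤square x)) (0≤+ (0≤ι n) 0≤1))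
      (lem p (ι n) x))
    (pow*[1+nx]≤1 0≤x x≤1 n))
  where
  p = pow (1ℚ - x) n
  lem : ∀ p n x → p * (1ℚ + n * x) ≡ p * (1ℚ - x) * (1ℚ + (n + 1ℚ) * x) + p * (x * x) * (n + 1ℚ)
  lem = solve-∀ ℚ-ring

-- Only `b` is confined to [0, 1], so that the step serves both Lipschitz estimates below.
∣pow-pow∣-step : ∀ a b n → 0ℚ ≤ b → b ≤ 1ℚ → ∣ pow a (suc n) - pow b (suc n) ∣ ≤
                 ∣ pow a n ∣ * ∣ a - b ∣ + ∣ pow a n - pow b n ∣
∣pow-pow∣-step a b n 0≤b b≤1 = begin
  ∣ pow a n * a - pow b n * b ∣
    ≡⟨ cong ∣_∣ (product-sub (pow a n) a (pow b n) b) ⟩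
  ∣ pow a n * (a - b) + (pow a n - pow b n) * b ∣
    ≤⟨ ∣p+q∣≤∣p∣+∣q∣ (pow a n * (a - b)) ((pow a n - pow b n) * b) ⟩
  ∣ pow a n * (a - b) ∣ + ∣ (pow a n - pow b n) * b ∣
    ≡⟨ cong₂ _+_ (∣p*q∣≡∣p∣*∣q∣ (pow a n) (a - b))
                 (trans (∣p*q∣≡∣p∣*∣q∣ (pow a n - pow b n) b) (cong (∣ pow a n - pow b n ∣ *_) (0≤p⇒∣p∣≡p 0≤b))) ⟩
  ∣ pow a n ∣ * ∣ a - b ∣ + ∣ pow a n - pow b n ∣ * b
    ≤⟨ +-monoʳ-≤ (∣ pow a n ∣ * ∣ a - b ∣)
         (≤-trans (*-monoˡ-≤-nonNeg ∣ pow a n - pow b n ∣ {{nonNegative (0≤∣p∣ (pow a n - pow b n))}} b≤1)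
                  (≤-reflexive (*-identityʳ ∣ pow a n - pow b n ∣))) ⟩
  ∣ pow a n ∣ * ∣ a - b ∣ + ∣ pow a n - pow b n ∣ ∎
  where open ≤-Reasoning

pow-lipschitz : ∀ {a b} → 0ℚ ≤ a → a ≤ 1ℚ → 0ℚ ≤ b → b ≤ 1ℚ → ∀ n →
                ∣ pow a n - pow b n ∣ ≤ ι n * ∣ a - b ∣
pow-lipschitz {a} {b} _   _   _   _   zero    = ≤-reflexive (sym (*-zeroˡ ∣ a - b ∣))
pow-lipschitz {a} {b} 0≤a a≤1 0≤b b≤1 (suc n) = begin
  ∣ pow a (suc n) - pow b (suc n) ∣
    ≤⟨ ∣pow-pow∣-step a b n 0≤b b≤1 ⟩
  ∣ pow a n ∣ * ∣ a - b ∣ + ∣ pow a n - pow b n ∣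
    ≤⟨ +-mono-≤ (*-monoʳ-≤-nonNeg ∣ a - b ∣ {{nonNegative (0≤∣p∣ (a - b))}}
                  (≤-trans (≤-reflexive (0≤p⇒∣p∣≡p (pow-nonneg 0≤a n))) (pow≤1 0≤a a≤1 n)))
                (pow-lipschitz 0≤a a≤1 0≤b b≤1 n) ⟩
  1ℚ * ∣ a - b ∣ + ι n * ∣ a - b ∣
    ≡⟨ lem ∣ a - b ∣ (ι n) ⟩
  (ι n + 1ℚ) * ∣ a - b ∣
    ≡⟨ cong (_* ∣ a - b ∣) (ι-suc n) ⟨
  ι (suc n) * ∣ a - b ∣ ∎
  where
  open ≤-Reasoning
  lem : ∀ d n → 1ℚ * d + n * d ≡ (n + 1ℚ) * d
  lem = solve-∀ ℚ-ring

-- For the approximations of pₙ, which may leave [0, 1]. The constant grows with n in an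
-- uncontrolled way, which is acceptable because m is chosen after n.
pow-lipschitz′ : ∀ n → ∃[ C ] 0ℚ ≤ C × (∀ {a b} → 0ℚ ≤ b → b ≤ 1ℚ → ∣ a - b ∣ ≤ 1ℚ →
                 ∣ pow a n - pow b n ∣ ≤ C * ∣ a - b ∣)
pow-lipschitz′ zero    = 0ℚ , ≤-refl , λ {a} {b} _ _ _ → ≤-reflexive (sym (*-zeroˡ ∣ a - b ∣))
pow-lipschitz′ (suc n) = let C , 0≤C , h = pow-lipschitz′ n in
  (C + 1ℚ) + C , 0≤+ (0≤+ 0≤C 0≤1) 0≤C , λ {a} {b} 0≤b b≤1 d≤1 → begin
    ∣ pow a (suc n) - pow b (suc n) ∣
      ≤⟨ ∣pow-pow∣-step a b n 0≤b b≤1 ⟩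
    ∣ pow a n ∣ * ∣ a - b ∣ + ∣ pow a n - pow b n ∣
      ≤⟨ +-mono-≤ (*-monoʳ-≤-nonNeg ∣ a - b ∣ {{nonNegative (0≤∣p∣ (a - b))}} (begin
           ∣ pow a n ∣                          ≤⟨ ∣p∣≤∣p-q∣+∣q∣ (pow a n) (pow b n) ⟩
           ∣ pow a n - pow b n ∣ + ∣ pow b n ∣  ≤⟨ +-mono-≤ (≤-trans (h 0≤b b≤1 d≤1) (*-monoˡ-≤-nonNeg C {{nonNegative 0≤C}} d≤1))
                                                  (≤-trans (≤-reflexive (0≤p⇒∣p∣≡p (pow-nonneg 0≤b n))) (pow≤1 0≤b b≤1 n)) ⟩
           C * 1ℚ + 1ℚ                          ≡⟨ cong (_+ 1ℚ) (*-identityʳ C) ⟩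
           C + 1ℚ                               ∎))
         (h 0≤b b≤1 d≤1) ⟩
    (C + 1ℚ) * ∣ a - b ∣ + C * ∣ a - b ∣
      ≡⟨ *-distribʳ-+ ∣ a - b ∣ (C + 1ℚ) C ⟨
    ((C + 1ℚ) + C) * ∣ a - b ∣ ∎
  where open ≤-Reasoning

-- (1 - v)ⁿ ≤ exp (- nv) ≤ (1 + v)⁻ⁿ, and these bounds are close because
-- (1 - v)ⁿ (1 + v)ⁿ = (1 - v²)ⁿ ≥ 1 - nv².

module _ {v : ℚ} (0≤v : 0ℚ ≤ v) (v≤1 : v ≤ 1ℚ) (n : ℕ) where

  expSum*pow≤1 : ∀ j → expSum (ι n * v) j * pow (1ℚ - v) n ≤ 1ℚ
  expSum*pow≤1 j = subst (λ z → expSum z j * pow (1ℚ - v) n ≤ 1ℚ) (∑<-const n v)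
    (expSum*∏[1-h]≤1 (λ _ → 0≤v) (λ _ → v≤1) n j)

  pow≤expSum : ∀ {m} → suc n ℕ.≤ m → pow (1ℚ + v) n ≤ expSum (ι n * v) m
  pow≤expSum n<m = ≤-trans
    (subst (λ z → pow (1ℚ + v) n ≤ expSum z (suc n)) (∑<-const n v) (∏[1+h]≤expSum (λ _ → 0≤v) n))
    (expSum-incr (0≤* (0≤ι n) 0≤v) (ℕP.≤⇒≤′ n<m))

  1-nv²≤expSum*pow : ∀ {m} → suc n ℕ.≤ m → 1ℚ - ι n * (v * v) ≤ expSum (ι n * v) m * pow (1ℚ - v) n
  1-nv²≤expSum*pow {m} n<m = begin
    1ℚ - ι n * (v * v)                      ≤⟨ bernoulli (0≤square v) (*-mono-≤₀ 0≤1 0≤v v≤1 v≤1) n ⟩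
    pow (1ℚ - v * v) n                      ≡⟨ cong (λ z → pow z n) (lem v) ⟩
    pow ((1ℚ + v) * (1ℚ - v)) n             ≡⟨ pow-* (1ℚ + v) (1ℚ - v) n ⟩
    pow (1ℚ + v) n * pow (1ℚ - v) n         ≤⟨ *-monoʳ-≤-nonNeg (pow (1ℚ - v) n) {{nonNegative (pow-nonneg (0≤sub v≤1) n)}} (pow≤expSum n<m) ⟩
    expSum (ι n * v) m * pow (1ℚ - v) n     ∎
    where
    open ≤-Reasoning
    lem : ∀ v → 1ℚ - v * v ≡ (1ℚ + v) * (1ℚ - v)
    lem = solve-∀ ℚ-ring

  -- Multiplication by `S`, which is at least 1, can only enlarge the distance; afterwards both
  -- products `G * S` and `S * w` are compared with 1, and nothing has to be divided.
  pow-expSum-close : ∀ {m} → suc n ℕ.≤ m → ∀ {ε} → ∣ expSum (- (ι n * v)) m * expSum (ι n * v) m - 1ℚ ∣ ≤ ε →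
                     ∣ pow (1ℚ - v) n - expSum (- (ι n * v)) m ∣ ≤ ε + ι n * (v * v)
  pow-expSum-close {m} n<m {ε} GS≈1 = begin
    ∣ w - G ∣                             ≡⟨ *-identityʳ ∣ w - G ∣ ⟨
    ∣ w - G ∣ * 1ℚ                        ≤⟨ *-monoˡ-≤-nonNeg ∣ w - G ∣ {{nonNegative (0≤∣p∣ (w - G))}} 1≤S ⟩
    ∣ w - G ∣ * S                         ≡⟨ cong (∣ w - G ∣ *_) (0≤p⇒∣p∣≡p (≤-trans 0≤1 1≤S)) ⟨
    ∣ w - G ∣ * ∣ S ∣                     ≡⟨ ∣p*q∣≡∣p∣*∣q∣ (w - G) S ⟨
    ∣ (w - G) * S ∣                       ≡⟨ cong ∣_∣ (lem w G S) ⟩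
    ∣ (1ℚ - G * S) - (1ℚ - S * w) ∣       ≤⟨ ∣p-q∣≤∣p∣+∣q∣ (1ℚ - G * S) (1ℚ - S * w) ⟩
    ∣ 1ℚ - G * S ∣ + ∣ 1ℚ - S * w ∣       ≤⟨ +-mono-≤ (subst (_≤ ε) (∣-∣-sym (G * S) 1ℚ) GS≈1) (begin
      ∣ 1ℚ - S * w ∣                        ≡⟨ 0≤p⇒∣p∣≡p (0≤sub (expSum*pow≤1 m)) ⟩
      1ℚ - S * w                            ≤⟨ ≤-cert (S * w - (1ℚ - ι n * (v * v))) (0≤sub (1-nv²≤expSum*pow n<m)) (lem′ (S * w) (ι n * (v * v))) ⟩
      ι n * (v * v)                         ∎) ⟩
    ε + ι n * (v * v)                     ∎
    where
    open ≤-Reasoning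
    w = pow (1ℚ - v) n
    G = expSum (- (ι n * v)) m
    S = expSum (ι n * v) m
    1≤S : 1ℚ ≤ S
    1≤S = expSum-incr (0≤* (0≤ι n) 0≤v) (ℕP.≤⇒≤′ (ℕP.≤-trans (s≤s (z≤n {n})) n<m))
    lem : ∀ w G S → (w - G) * S ≡ (1ℚ - G * S) - (1ℚ - S * w)
    lem = solve-∀ ℚ-ring
    lem′ : ∀ a b → b ≡ 1ℚ - a + (a - (1ℚ - b))
    lem′ = solve-∀ ℚ-ring

-- With n = r + 1 and v = l/n, three replacements are made: x by v, at a cost of n |x - v| = |nx -
-- l|; the exponent r by n, at a cost of v; the power by the exponential, at a cost of ε′ + nv² = ε′
-- + lv.
pow-expSum-limit : ∀ {x l Λ ε ε′} r {m} → 0ℚ ≤ x → x ≤ 1ℚ → 0ℚ ≤ l → l ≤ Λ → Λ ≤ ι (suc r) →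
  ∣ ι (suc r) * x - l ∣ ≤ ε → suc (suc r) ℕ.≤ m → ∣ expSum (- l) m * expSum l m - 1ℚ ∣ ≤ ε′ →
  ∣ pow (1ℚ - x) r - expSum (- l) m ∣ ≤ ε + ε′ + (Λ + Λ * Λ) * recip r
pow-expSum-limit {x} {l} {Λ} {ε} {ε′} r {m} 0≤x x≤1 0≤l l≤Λ Λ≤n nx≈l n<m GS≈1 = begin
  ∣ pow (1ℚ - x) r - G ∣
    ≤⟨ ∣-∣-triangle (pow (1ℚ - x) r) (pow (1ℚ - v) r) G ⟩
  ∣ pow (1ℚ - x) r - pow (1ℚ - v) r ∣ + ∣ pow (1ℚ - v) r - G ∣
    ≤⟨ +-mono-≤ x≈v (∣-∣-triangle (pow (1ℚ - v) r) (pow (1ℚ - v) n) G) ⟩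
  ε + (∣ pow (1ℚ - v) r - pow (1ℚ - v) n ∣ + ∣ pow (1ℚ - v) n - G ∣)
    ≤⟨ +-monoʳ-≤ ε (+-mono-≤ r≈n n≈G) ⟩
  ε + (Λ * recip r + (ε′ + Λ * Λ * recip r))
    ≡⟨ lem ε ε′ Λ (recip r) ⟩
  ε + ε′ + (Λ + Λ * Λ) * recip r ∎
  where
  open ≤-Reasoning
  n = suc r
  v = l * recip r
  G = expSum (- l) m
  nv≡l : ι n * v ≡ l
  nv≡l = ≡-cert₁ l (recip-inverseʳ r) (lem₁ (ι n) l (recip r))
    where
    lem₁ : ∀ n l r → n * (l * r) ≡ l + l * (n * r - 1ℚ)
    lem₁ = solve-∀ ℚ-ring
  0≤v = 0≤* 0≤l (0≤recip r)
  v≤Λ/n : v ≤ Λ * recip r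
  v≤Λ/n = *-monoʳ-≤-nonNeg (recip r) {{nonNegative (0≤recip r)}} l≤Λ
  v≤1 : v ≤ 1ℚ
  v≤1 = ≤-trans v≤Λ/n (subst (Λ * recip r ≤_) (recip-inverseʳ r)
    (*-monoʳ-≤-nonNeg (recip r) {{nonNegative (0≤recip r)}} Λ≤n))
  1-≤1 : ∀ {z} → 0ℚ ≤ z → 1ℚ - z ≤ 1ℚ
  1-≤1 {z} 0≤z = ≤-cert z 0≤z (sym (sub-add 1ℚ z))
  x≈v : ∣ pow (1ℚ - x) r - pow (1ℚ - v) r ∣ ≤ ε
  x≈v = begin
    ∣ pow (1ℚ - x) r - pow (1ℚ - v) r ∣
      ≤⟨ pow-lipschitz (0≤sub x≤1) (1-≤1 0≤x) (0≤sub v≤1) (1-≤1 0≤v) r ⟩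
    ι r * ∣ 1ℚ - x - (1ℚ - v) ∣
      ≤⟨ *-monoʳ-≤-nonNeg _ {{nonNegative (0≤∣p∣ (1ℚ - x - (1ℚ - v)))}} (ι-mono (ℕP.n≤1+n r)) ⟩
    ι n * ∣ 1ℚ - x - (1ℚ - v) ∣
      ≡⟨ cong (_* ∣ 1ℚ - x - (1ℚ - v) ∣) (0≤p⇒∣p∣≡p (0≤ι n)) ⟨
    ∣ ι n ∣ * ∣ 1ℚ - x - (1ℚ - v) ∣
      ≡⟨ ∣p*q∣≡∣p∣*∣q∣ (ι n) (1ℚ - x - (1ℚ - v)) ⟨
    ∣ ι n * (1ℚ - x - (1ℚ - v)) ∣
      ≡⟨ cong ∣_∣ (lem₁ (ι n) x v) ⟩
    ∣ ι n * v - ι n * x ∣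
      ≡⟨ cong (λ z → ∣ z - ι n * x ∣) nv≡l ⟩
    ∣ l - ι n * x ∣
      ≡⟨ ∣-∣-sym l (ι n * x) ⟩
    ∣ ι n * x - l ∣
      ≤⟨ nx≈l ⟩
    ε ∎
    where
    lem₁ : ∀ n x v → n * (1ℚ - x - (1ℚ - v)) ≡ n * v - n * x
    lem₁ = solve-∀ ℚ-ring
  r≈n : ∣ pow (1ℚ - v) r - pow (1ℚ - v) n ∣ ≤ Λ * recip r
  r≈n = begin
    ∣ p - p * (1ℚ - v) ∣    ≡⟨ cong ∣_∣ (lem₁ p v) ⟩
    ∣ p * v ∣               ≡⟨ 0≤p⇒∣p∣≡p (0≤* 0≤p 0≤v) ⟩
    p * v                   ≤⟨ *-mono-≤₀ 0≤1 0≤v (pow≤1 (0≤sub v≤1) (1-≤1 0≤v) r) v≤Λ/n ⟩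
    1ℚ * (Λ * recip r)      ≡⟨ *-identityˡ (Λ * recip r) ⟩
    Λ * recip r             ∎
    where
    p = pow (1ℚ - v) r
    0≤p = pow-nonneg (0≤sub v≤1) r
    lem₁ : ∀ p v → p - p * (1ℚ - v) ≡ p * v
    lem₁ = solve-∀ ℚ-ring
  n≈G : ∣ pow (1ℚ - v) n - G ∣ ≤ ε′ + Λ * Λ * recip r
  n≈G = begin
    ∣ pow (1ℚ - v) n - G ∣
      ≡⟨ cong (λ z → ∣ pow (1ℚ - v) n - expSum (- z) m ∣) nv≡l ⟨
    ∣ pow (1ℚ - v) n - expSum (- (ι n * v)) m ∣
      ≤⟨ pow-expSum-close 0≤v v≤1 n n<m (subst (λ z → ∣ expSum (- z) m * expSum z m - 1ℚ ∣ ≤ ε′) (sym nv≡l) GS≈1) ⟩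
    ε′ + ι n * (v * v)
      ≡⟨ cong (ε′ +_) (trans (sym (*-assoc (ι n) v v)) (cong (_* v) nv≡l)) ⟩
    ε′ + l * v
      ≤⟨ +-monoʳ-≤ ε′ (*-mono-≤₀ (≤-trans 0≤l l≤Λ) 0≤v l≤Λ v≤Λ/n) ⟩
    ε′ + Λ * (Λ * recip r)
      ≡⟨ cong (ε′ +_) (*-assoc Λ Λ (recip r)) ⟨
    ε′ + Λ * Λ * recip r ∎
  lem : ∀ ε ε′ Λ r → ε + (Λ * r + (ε′ + Λ * Λ * r)) ≡ ε + ε′ + (Λ + Λ * Λ) * r
  lem = solve-∀ ℚ-ring

∣-∣≤⇒≤ : ∀ p q {ε} → ∣ p - q ∣ ≤ ε → p ≤ q + ε
∣-∣≤⇒≤ p q {ε} h = subst₂ _≤_ (sub-add p q) (+-comm ε q) (+-monoˡ-≤ q (≤-trans (p≤∣p∣ (p - q)) h))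

-- A division-free form of z ≤ c/w ≤ η.
≤-by-product : ∀ {c z w η} → 0ℚ < c → 0ℚ ≤ z → 0ℚ ≤ η → z * w ≤ c → c ≤ η * w → z ≤ η
≤-by-product {c} {z} {w} {η} 0<c 0≤z 0≤η zw≤c c≤ηw = *-cancelʳ-≤-pos c {{positive 0<c}} (begin
  z * c        ≤⟨ *-monoˡ-≤-nonNeg z {{nonNegative 0≤z}} c≤ηw ⟩
  z * (η * w)  ≡⟨ swap-front z η w ⟩
  η * (z * w)  ≤⟨ *-monoˡ-≤-nonNeg η {{nonNegative 0≤η}} zw≤c ⟩
  η * c        ∎)
  where open ≤-Reasoning

0≤factor : ∀ {p q} → 0ℚ ≤ q → 0ℚ < p * q → 0ℚ ≤ p
0≤factor {p} {q} 0≤q 0<pq with ≤-total 0ℚ p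
... | inj₁ 0≤p = 0≤p
... | inj₂ p≤0 = contradiction (begin-strict
  0ℚ      <⟨ 0<pq ⟩
  p * q   ≤⟨ *-monoʳ-≤-nonNeg q {{nonNegative 0≤q}} p≤0 ⟩
  0ℚ * q  ≡⟨ *-zeroˡ q ⟩
  0ℚ      ∎) (<-irrefl {0ℚ} refl)
  where open ≤-Reasoning

2ℚ 4ℚ : ℚ
2ℚ = 1ℚ + 1ℚ
4ℚ = 2ℚ + 2ℚ

-- The power n^(-α), where a m is the m-th approximation of α.

module _ (a : ℕ → ℚ) where

  exponent : ℕ → ℕ → ℚ
  exponent n m = a m * lnSum n m

  power : ℕ → ℕ → ℚ
  power n m = expSum (- exponent n m) m

  -- What holds for fixed n and all large m. The two bounds on e⁻ʸ eʸ stand in for the equation e⁻ʸ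
  -- eʸ = 1; `lastTerm≤1` controls the term by which a sum and its derivative differ.
  record Regular (n m : ℕ) : Set where
    field
      2≤m         : 2 ℕ.≤ m
      0≤a         : 0ℚ ≤ a m
      0≤exponent  : 0ℚ ≤ exponent n m
      0≤power     : 0ℚ ≤ power n m
      ½≤e⁻ʸeʸ     : ½ ≤ power n m * expSum (exponent n m) m
      e⁻ʸeʸ≤2     : power n m * expSum (exponent n m) m ≤ 2ℚ
      lastTerm≤1  : expTerm (exponent n m) (m ∸ 1) ≤ 1ℚ

  module _ {A : ℚ} (0≤A : 0ℚ ≤ A) (a-bounded : Eventually (λ m → 0ℚ ≤ a m × a m ≤ A)) where

    power-inverse : ∀ n {ε} → 0ℚ < ε →
      Eventually (λ m → 0ℚ ≤ exponent (suc n) m × exponent (suc n) m ≤ A * ι (suc n) ×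
                        ∣ power (suc n) m * expSum (exponent (suc n) m) m - 1ℚ ∣ ≤ ε)
    power-inverse n {ε} 0<ε = shift-ev (map-ev bound (unshift-ev (a-bounded ,ᵉ expSum-neg-small (0≤* 0≤A (0≤ι (suc n))) 0<ε)))
      where
      bound : ∀ k → (0ℚ ≤ a (suc k) × a (suc k) ≤ A) ×
                    (∀ {y} → 0ℚ ≤ y → y ≤ A * ι (suc n) → ∣ expSum (- y) (suc k) * expSum y (suc k) - 1ℚ ∣ ≤ ε) →
              0ℚ ≤ exponent (suc n) (suc k) × exponent (suc n) (suc k) ≤ A * ι (suc n) ×
              ∣ power (suc n) (suc k) * expSum (exponent (suc n) (suc k)) (suc k) - 1ℚ ∣ ≤ ε
      bound k ((0≤a , a≤A) , inv) = 0≤y , y≤ , inv {exponent (suc n) (suc k)} 0≤y y≤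
        where
        0≤y = 0≤* 0≤a (lnSum-nonneg (suc n) (suc k))
        y≤ = *-mono-≤₀ 0≤A (lnSum-nonneg (suc n) (suc k)) a≤A (lnSum≤ι n k)

    regular : ∀ n → Eventually (Regular (suc n))
    regular n = shift-ev (map-ev bound
      (unshift-ev ((2 , λ _ 2≤m → 2≤m) ,ᵉ (a-bounded ,ᵉ power-inverse n (positive⁻¹ ½)))
       ,ᵉ expTerm-small (0≤* 0≤A (0≤ι (suc n))) (positive⁻¹ 1ℚ)))
      where
      bound : ∀ m → _ → _
      bound m ((2≤m , (0≤a , _) , 0≤y , y≤ , inv) , t≤1) = record
        { 2≤m = 2≤m
        ; 0≤a = 0≤a
        ; 0≤exponent = 0≤y
        ; 0≤power = 0≤e
        ; ½≤e⁻ʸeʸ = ½≤eF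
        ; e⁻ʸeʸ≤2 = ≤-trans (∣-∣≤⇒≤ (e * F) 1ℚ inv) (≤-cert ½ (nonNegative⁻¹ ½) refl)
        ; lastTerm≤1 = ≤-trans (expTerm-mono 0≤y y≤ m) t≤1
        }
        where
        e = power (suc n) (suc m)
        F = expSum (exponent (suc n) (suc m)) (suc m)
        lem : ∀ p → p ≡ ½ + (p + ½ - 1ℚ)
        lem = solve-∀ ℚ-ring
        ½≤eF : ½ ≤ e * F
        ½≤eF = ≤-cert (e * F + ½ - 1ℚ) (0≤sub (∣-∣≤⇒≤ 1ℚ (e * F) (subst (_≤ ½) (∣-∣-sym (e * F) 1ℚ) inv))) (lem (e * F))
        -- The sign of the alternating sum `e` follows from that of `F` and of the product.
        0≤e : 0ℚ ≤ e
        0≤e = 0≤factor (expSum-nonneg 0≤y (suc m)) (<-≤-trans (positive⁻¹ ½) ½≤eF)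

    -- From eʸ ≥ y ≥ a₀ ln n one gets e⁻ʸ ≤ 2/(a₀ ln n). This weak decay holds for every α > 0 and
    -- serves to bring 1 - pₙ below 1.
    power-small : ∀ {a₀} → 0ℚ < a₀ → Eventually (λ m → a₀ ≤ a m) → ∀ {η} → 0ℚ < η →
                  Eventually (λ n → Eventually (λ m → power n m ≤ η))
    power-small {a₀} 0<a₀ a₀≤a {η} 0<η =
      let b , h = exceed (0<* 0<η 0<a₀) 2ℚ
      in shift-ev (map-ev (λ n B≤L → shift-ev (map-ev (λ k → bound b (h b ℕP.≤-refl) n B≤L k)
           (unshift-ev (regular n ,ᵉ a₀≤a)))) (unshift-ev (lnSum-unbounded (0≤ι b))))
      where
      bound : ∀ b → 2ℚ ≤ η * a₀ * ι b → ∀ n → (∀ k → ι b ≤ lnSum (suc n) (suc k)) →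
              ∀ k → Regular (suc n) (suc k) × a₀ ≤ a (suc k) → power (suc n) (suc k) ≤ η
      bound b 2≤ n B≤L k (reg , a₀≤a) = ≤-by-product (positive⁻¹ 2ℚ) 0≤power (<⇒≤ 0<η)
        (begin
          e * (a₀ * ι b)   ≤⟨ *-monoˡ-≤-nonNeg e {{nonNegative 0≤power}} (begin
            a₀ * ι b         ≤⟨ *-mono-≤₀ 0≤a (0≤ι b) a₀≤a (B≤L k) ⟩
            y                ≡⟨ +-identityˡ y ⟨
            0ℚ + y           ≤⟨ +-monoˡ-≤ y 0≤1 ⟩
            1ℚ + y           ≤⟨ 1+x≤expSum 0≤exponent 2≤m ⟩
            F                ∎) ⟩
          e * F            ≤⟨ e⁻ʸeʸ≤2 ⟩
          2ℚ               ∎)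
        (≤-trans 2≤ (≤-reflexive (*-assoc η a₀ (ι b))))
        where
        open ≤-Reasoning
        open Regular reg
        e = power (suc n) (suc k)
        y = exponent (suc n) (suc k)
        F = expSum y (suc k)

    -- α > 1: by convexity exp (α ln n) ≥ n (1 + (α - 1) ln n).
    n*power-small : ∀ {δ} → 0ℚ < δ → Eventually (λ m → 1ℚ + δ ≤ a m) → ∀ {η} → 0ℚ < η →
                    Eventually (λ n → Eventually (λ m → ι n * power n m ≤ η))
    n*power-small {δ} 0<δ 1+δ≤a {η} 0<η =
      -- One factor 2 pays for `n≤2S`, the other for `e⁻ʸeʸ≤2`.
      let b , h = exceed (0<* 0<η 0<δ) 4ℚ
      in shift-ev (shift-ev (map-ev (λ n B≤L → shift-ev (map-ev (λ k → bound b (h b ℕP.≤-refl) n B≤L k)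
           (unshift-ev (regular (suc n) ,ᵉ 1+δ≤a) ,ᵉ ι-small≤expSum-lnSum n (positive⁻¹ ½))))
           (unshift-ev (unshift-ev (lnSum-unbounded (0≤ι b))))))
      where
      bound : ∀ b → 4ℚ ≤ η * δ * ι b → ∀ n → (∀ k → ι b ≤ lnSum (suc (suc n)) (suc k)) →
              ∀ k → (Regular (suc (suc n)) (suc k) × 1ℚ + δ ≤ a (suc k)) × ι (suc (suc n)) - ½ ≤ expSum (lnSum (suc (suc n)) (suc k)) k →
              ι (suc (suc n)) * power (suc (suc n)) (suc k) ≤ η
      bound b 4≤ n′ B≤L k ((reg , 1+δ≤a) , n-½≤S) = ≤-by-product (positive⁻¹ 4ℚ) (0≤* (0≤ι n) 0≤power) (<⇒≤ 0<η)
        (begin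
          ι n * e * (δ * ι b)
            ≤⟨ *-mono-≤₀ (0≤* (0≤* (0≤+ 0≤1 0≤1) S≥0) 0≤power) (0≤* (<⇒≤ 0<δ) (0≤ι b))
                 (*-monoʳ-≤-nonNeg e {{nonNegative 0≤power}} n≤2S)
                 (*-monoˡ-≤-nonNeg δ {{nonNegative (<⇒≤ 0<δ)}} (B≤L k)) ⟩
          2ℚ * S * e * (δ * L)
            -- The tangent at ln n gives F ≥ (y - L) S ≥ δ L S.
            ≤⟨ ≤-cert (2ℚ * e * ((F - (S + t + (y - L) * S)) + (a (suc k) - (1ℚ + δ)) * L * S + S + t))
                 (0≤* (0≤* (0≤+ 0≤1 0≤1) 0≤power)
                   (0≤+ (0≤+ (0≤+ (0≤sub (expSum-tangent 0≤exponent 0≤L k))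
                                  (0≤* (0≤* (0≤sub 1+δ≤a) 0≤L) S≥0))
                             S≥0)
                        (expTerm-nonneg 0≤L k)))
                 (lem (a (suc k)) δ L S e F t) ⟩
          2ℚ * (e * F)
            ≤⟨ *-monoˡ-≤-nonNeg 2ℚ e⁻ʸeʸ≤2 ⟩
          4ℚ ∎)
        (≤-trans 4≤ (≤-reflexive (*-assoc η δ (ι b))))
        where
        open ≤-Reasoning
        open Regular reg
        n = suc (suc n′)
        L = lnSum n (suc k)
        0≤L = lnSum-nonneg n (suc k)
        y = exponent n (suc k)
        e = power n (suc k)
        F = expSum y (suc k)
        S = expSum L k
        t = expTerm L k
        S≥0 = expSum-nonneg 0≤L k
        lem : ∀ a δ L S e F t → 2ℚ * (e * F) ≡ 2ℚ * S * e * (δ * L) +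
              (2ℚ * e * ((F - (S + t + (a * L - L) * S)) + (a - (1ℚ + δ)) * L * S + S + t))
        lem = solve-∀ ℚ-ring
        n≤2S : ι n ≤ 2ℚ * S
        n≤2S = ≤-cert (2ℚ * (S - (ι n - ½)) + (ι n - 1ℚ))
          (0≤+ (0≤* (0≤+ 0≤1 0≤1) (0≤sub n-½≤S)) (0≤sub (ι-mono {1} {n} (s≤s z≤n))))
          (lem′ S (ι n))
          where
          lem′ : ∀ S n → 2ℚ * S ≡ n + (2ℚ * (S - (n - ½)) + (n - 1ℚ))
          lem′ = solve-∀ ℚ-ring

    -- α < 1: by convexity n ≥ exp (α ln n) (1 + (1 - α) ln n).
    n*power-large : ∀ {δ} → 0ℚ < δ → Eventually (λ m → a m + δ ≤ 1ℚ) → ∀ C →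
                    Eventually (λ n → Eventually (λ m → C ≤ ι n * power n m))
    n*power-large {δ} 0<δ a+δ≤1 C =
      -- One factor 2 comes from `½≤e⁻ʸeʸ`, the other from S + t ≤ 2S.
      let b , h = exceed 0<δ (4ℚ * C)
      in shift-ev (map-ev (λ n B≤L → shift-ev (map-ev (λ k → bound b (h b ℕP.≤-refl) n B≤L k)
           (unshift-ev (regular n ,ᵉ a+δ≤1))))
           (unshift-ev (lnSum-unbounded (0≤ι b))))
      where
      bound : ∀ b → 4ℚ * C ≤ δ * ι b → ∀ n → (∀ k → ι b ≤ lnSum (suc n) (suc k)) →
              ∀ k → Regular (suc n) (suc k) × a (suc k) + δ ≤ 1ℚ → C ≤ ι (suc n) * power (suc n) (suc k)
      -- For m = 1 the sum `S` would be empty and t ≤ S would fail.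
      bound b 4C≤ n′ B≤L zero (reg , _) = contradiction (Regular.2≤m reg) λ { (s≤s ()) }
      bound b 4C≤ n′ B≤L (suc k′) (reg , a+δ≤1) = *-cancelˡ-≤-pos 4ℚ (begin
        4ℚ * C                      ≤⟨ 4C≤ ⟩
        δ * ι b                     ≤⟨ *-monoˡ-≤-nonNeg δ {{nonNegative (<⇒≤ 0<δ)}} (B≤L k) ⟩
        δ * L                       ≡⟨ lem₀ (δ * L) ⟩
        2ℚ * (δ * L * ½)            ≤⟨ *-monoˡ-≤-nonNeg 2ℚ (*-monoˡ-≤-nonNeg (δ * L) {{nonNegative (0≤* (<⇒≤ 0<δ) 0≤L)}} ½≤e⁻ʸeʸ) ⟩
        2ℚ * (δ * L * (e * (S + t)))  ≤⟨ ≤-cert (2ℚ * e * (δ * L * (S - t) + 2ℚ * ((1ℚ - (a (suc k) + δ)) * L * S) + 2ℚ * (S + t)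
                                         + 2ℚ * (N - (S + t + (L - y) * S))))
                                     (0≤* (0≤* (0≤+ 0≤1 0≤1) 0≤power)
                                       (0≤+ (0≤+ (0≤+ (0≤* (0≤* (<⇒≤ 0<δ) 0≤L) (0≤sub t≤S))
                                                      (0≤* (0≤+ 0≤1 0≤1) (0≤* (0≤* (0≤sub a+δ≤1) 0≤L) S≥0)))
                                                 (0≤* (0≤+ 0≤1 0≤1) (expSum-nonneg 0≤exponent (suc k))))
                                            (0≤* (0≤+ 0≤1 0≤1) (0≤sub (≤-trans (expSum-tangent 0≤L 0≤exponent k) (expSum-lnSum≤ n′ k (suc k)))))))
                                     (lem (a (suc k)) δ L S t e N) ⟩
        4ℚ * (N * e)                ∎)
        where
        open ≤-Reasoning
        open Regular reg
        k = suc k′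
        n = suc n′
        N = ι n
        L = lnSum n (suc k)
        0≤L = lnSum-nonneg n (suc k)
        y = exponent n (suc k)
        e = power n (suc k)
        S = expSum y k
        t = expTerm y k
        S≥0 = expSum-nonneg 0≤exponent k
        -- The product with `e` is controlled for the full sum S + t, while the tangent has slope
        -- `S`; this inequality trades one for the other.
        t≤S : t ≤ S
        t≤S = ≤-trans lastTerm≤1 (1≤expSum 0≤exponent k′)
        lem₀ : ∀ z → z ≡ 2ℚ * (z * ½)
        lem₀ = solve-∀ ℚ-ring
        lem : ∀ a δ L S t e N → 4ℚ * (N * e) ≡ 2ℚ * (δ * L * (e * (S + t))) +
              (2ℚ * e * (δ * L * (S - t) + 2ℚ * ((1ℚ - (a + δ)) * L * S) + 2ℚ * (S + t)
                                         + 2ℚ * (N - (S + t + (L - a * L) * S))))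
        lem = solve-∀ ℚ-ring

    -- Here n is fixed and only m grows: `S` approximates exp (ln n) = n, and `F` is close to `S`
    -- because exp is Lipschitz on [0, K] and the exponents differ by (1 - a) ln n.
    n*power≈1 : (∀ {η} → 0ℚ < η → Eventually (λ m → ∣ a m - 1ℚ ∣ ≤ η)) →
                ∀ n {ε} → 0ℚ < ε → Eventually (λ m → ∣ ι (suc (suc n)) * power (suc (suc n)) m - 1ℚ ∣ ≤ ε)
    n*power≈1 a≈1 n′ {ε} 0<ε =
      let D , _ , S≤D = expSum-bounded 0≤K
          η₁ , 0<η₁ , 2η₁≤ = shrink 0<q 2ℚ
          η₂ , 0<η₂ , Dη₂≤ = shrink 0<q (2ℚ * (D * N))
      in shift-ev (map-ev (λ k → bound S≤D 2η₁≤ (<⇒≤ 0<η₂) Dη₂≤ k)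
           (unshift-ev (regular (suc n′) ,ᵉ power-inverse (suc n′) (0<ε½ 0<ε) ,ᵉ a≈1 0<η₂)
            ,ᵉ ι-small≤expSum-lnSum n′ 0<η₁))
      where
      open ≤-Reasoning
      q = ε * ½ * ½
      0<q = 0<ε½ (0<ε½ 0<ε)
      n = suc (suc n′)
      N = ι n
      0≤N = 0≤ι n
      -- Large enough for both arguments, ln n ≤ N and α ln n ≤ A N.
      K = A * N + N
      0≤K : 0ℚ ≤ K
      0≤K = 0≤+ (0≤* 0≤A 0≤N) 0≤N
      M = proj₁ (archimedean (K + K))
      2K≤M = proj₂ (archimedean (K + K))
      bound : ∀ {D η₁ η₂} → (∀ m → expSum K m ≤ D) → 2ℚ * η₁ ≤ q → 0ℚ ≤ η₂ → 2ℚ * (D * N) * η₂ ≤ q → ∀ k →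
              (Regular n (suc k) ×
               (0ℚ ≤ exponent n (suc k) × exponent n (suc k) ≤ A * N ×
                ∣ power n (suc k) * expSum (exponent n (suc k)) (suc k) - 1ℚ ∣ ≤ ε * ½) ×
               ∣ a (suc k) - 1ℚ ∣ ≤ η₂) ×
              N - η₁ ≤ expSum (lnSum n (suc k)) k →
              ∣ N * power n (suc k) - 1ℚ ∣ ≤ ε
      bound {D} {η₁} {η₂} S≤D 2η₁≤ 0≤η₂ Dη₂≤ k ((reg , (_ , y≤ , eF≈1) , a≈1) , N-η₁≤S) = begin
        ∣ N * e - 1ℚ ∣
          ≡⟨ cong ∣_∣ (lem N e S F) ⟩
        ∣ e * ((N - S) + (S - F)) + (e * F - 1ℚ) ∣
          ≤⟨ ∣p+q∣≤∣p∣+∣q∣ (e * ((N - S) + (S - F))) (e * F - 1ℚ) ⟩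
        ∣ e * ((N - S) + (S - F)) ∣ + ∣ e * F - 1ℚ ∣
          ≤⟨ +-mono-≤ (begin
               ∣ e * ((N - S) + (S - F)) ∣
                 ≡⟨ trans (∣p*q∣≡∣p∣*∣q∣ e ((N - S) + (S - F))) (cong (_* ∣ (N - S) + (S - F) ∣) (0≤p⇒∣p∣≡p 0≤power)) ⟩
               e * ∣ (N - S) + (S - F) ∣
                 ≤⟨ *-mono-≤₀ (0≤+ 0≤1 0≤1) (0≤∣p∣ ((N - S) + (S - F))) e≤2
                      (≤-trans (∣p+q∣≤∣p∣+∣q∣ (N - S) (S - F)) (+-mono-≤ N-S≤ S-F≤)) ⟩
               2ℚ * (η₁ + D * (η₂ * N))
                 ≡⟨ lem₂ η₁ η₂ D N ⟩
               2ℚ * η₁ + 2ℚ * (D * N) * η₂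
                 ≤⟨ +-mono-≤ 2η₁≤ Dη₂≤ ⟩
               q + q
                 ≡⟨ halves (ε * ½) ⟩
               ε * ½ ∎)
             eF≈1 ⟩
        ε * ½ + ε * ½
          ≡⟨ halves ε ⟩
        ε ∎
        where
        open Regular reg
        L = lnSum n (suc k)
        0≤L = lnSum-nonneg n (suc k)
        y = exponent n (suc k)
        e = power n (suc k)
        F = expSum y (suc k)
        S = expSum L (suc k)
        lem : ∀ N e S F → N * e - 1ℚ ≡ e * ((N - S) + (S - F)) + (e * F - 1ℚ)
        lem = solve-∀ ℚ-ring
        lem₂ : ∀ a b D N → 2ℚ * (a + D * (b * N)) ≡ 2ℚ * a + 2ℚ * (D * N) * b
        lem₂ = solve-∀ ℚ-ring
        e≤2 : e ≤ 2ℚ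
        e≤2 = begin
          e        ≡⟨ *-identityʳ e ⟨
          e * 1ℚ   ≤⟨ *-monoˡ-≤-nonNeg e {{nonNegative 0≤power}} (1≤expSum 0≤exponent k) ⟩
          e * F    ≤⟨ e⁻ʸeʸ≤2 ⟩
          2ℚ       ∎
        N-S≤ : ∣ N - S ∣ ≤ η₁
        N-S≤ = begin
          ∣ N - S ∣      ≡⟨ 0≤p⇒∣p∣≡p (0≤sub (expSum-lnSum≤ (suc n′) k (suc k))) ⟩
          N - S          ≤⟨ +-monoʳ-≤ N (neg-antimono-≤ (≤-trans N-η₁≤S (≤-cert _ (expTerm-nonneg 0≤L k) refl))) ⟩
          N - (N - η₁)   ≡⟨ lem₃ N η₁ ⟩
          η₁             ∎
          where
          lem₃ : ∀ n e → n - (n - e) ≡ e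
          lem₃ = solve-∀ ℚ-ring
        S-F≤ : ∣ S - F ∣ ≤ D * (η₂ * N)
        S-F≤ = begin
          ∣ S - F ∣                          ≤⟨ expSum-lipschitz 0≤K M 2K≤M
                                                  (subst (_≤ K) (sym (0≤p⇒∣p∣≡p 0≤L)) (≤-trans (lnSum≤ι (suc n′) k) (≤-cert (A * N) (0≤* 0≤A 0≤N) (+-comm (A * N) N))))
                                                  (subst (_≤ K) (sym (0≤p⇒∣p∣≡p 0≤exponent)) (≤-trans y≤ (≤-cert N 0≤N refl)))
                                                  (suc k) ⟩
          expSum K (suc k) * ∣ L - y ∣       ≡⟨ cong (λ z → expSum K (suc k) * ∣ z ∣) (lem₃ (a (suc k)) L) ⟩
          expSum K (suc k) * ∣ (1ℚ - a (suc k)) * L ∣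
                                             ≡⟨ cong (expSum K (suc k) *_) (trans (∣p*q∣≡∣p∣*∣q∣ (1ℚ - a (suc k)) L)
                                                  (cong₂ _*_ (∣-∣-sym 1ℚ (a (suc k))) (0≤p⇒∣p∣≡p 0≤L))) ⟩
          expSum K (suc k) * (∣ a (suc k) - 1ℚ ∣ * L)
                                             ≤⟨ *-mono-≤₀ (≤-trans (expSum-nonneg 0≤K (suc k)) (S≤D (suc k)))
                                                  (0≤* (0≤∣p∣ (a (suc k) - 1ℚ)) 0≤L)
                                                  (S≤D (suc k))
                                                  (*-mono-≤₀ 0≤η₂ 0≤L a≈1 (lnSum≤ι (suc n′) k)) ⟩
          D * (η₂ * N)                       ∎
          where
          lem₃ : ∀ a L → L - a * L ≡ (1ℚ - a) * L
          lem₃ = solve-∀ ℚ-ring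

-- The shuffle and the game

-- The ordered deck with a variable first label, so that an induction can remove the top card.
deckFrom : ∀ a k → Vec ℕ k
deckFrom a zero    = []
deckFrom a (suc k) = suc a ∷ deckFrom (suc a) k

-- The history a, ..., 1, most recent card first as `guess` expects.
shownTo : ℕ → List ℕ
shownTo a = map suc (downFrom a)

tabulate≡deckFrom : ∀ {k} a (f : Fin k → ℕ) → (∀ i → f i ≡ suc (a ℕ.+ toℕ i)) → tabulate f ≡ deckFrom a k
tabulate≡deckFrom {zero}  a f h = refl
tabulate≡deckFrom {suc k} a f h = cong₂ _∷_
  (trans (h Fin.zero) (cong suc (ℕP.+-identityʳ a)))
  (tabulate≡deckFrom (suc a) (f ∘ Fin.suc) λ i → trans (h (Fin.suc i)) (cong suc (ℕP.+-suc a (toℕ i))))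

length-shuffle : ∀ {k} (deck : Vec ℕ k) (ω : Vec Place k) → length (shuffle deck ω) ≡ k
length-shuffle []         []           = refl
length-shuffle (c ∷ deck) (top ∷ ω)    = cong suc (length-shuffle deck ω)
length-shuffle (c ∷ deck) (bottom ∷ ω) = trans (length-++ (shuffle deck ω))
  (trans (ℕP.+-comm (length (shuffle deck ω)) 1) (cong suc (length-shuffle deck ω)))

shuffle-deckFrom> : ∀ a {k} (ω : Vec Place k) → All (a ℕ.<_) (shuffle (deckFrom a k) ω)
shuffle-deckFrom> a []           = []
shuffle-deckFrom> a (top ∷ ω)    = ℕP.≤-refl ∷ All.map ℕP.<⇒≤ (shuffle-deckFrom> (suc a) ω)
shuffle-deckFrom> a (bottom ∷ ω) = AllP.∷ʳ⁺ (All.map ℕP.<⇒≤ (shuffle-deckFrom> (suc a) ω)) ℕP.≤-refl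

shownTo≤ : ∀ a → All (ℕ._≤ a) (shownTo a)
shownTo≤ a = AllP.map⁺ (AllP.applyDownFrom⁺₁ (λ i → i) a λ i<a → i<a)

>⇒∉shownTo : ∀ {a c} → a ℕ.< c → c ∉ shownTo a
>⇒∉shownTo {a} a<c c∈ = ℕP.<⇒≱ a<c (All.lookup (shownTo≤ a) c∈)

-- The hypothesis places a below n - 1, so neither card that triggers the descending rule has been
-- shown.
guess-next : ∀ a {n} → suc a ℕ.< n → guess n (shownTo a) ≡ suc a
guess-next zero    _   = refl
guess-next (suc a) {suc n} (s≤s a<n)
  rewrite dec-false (_∈?_ ℕ._≟_ n (shownTo (suc a))) (>⇒∉shownTo a<n)
        | dec-false (_∈?_ ℕ._≟_ (suc n) (shownTo (suc a))) (>⇒∉shownTo (ℕP.m≤n⇒m≤1+n a<n))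
  = refl

largestUnseen-last : ∀ a → largestUnseen (suc a) (shownTo a) ≡ suc a
largestUnseen-last a = max≈v⁺ {xs = filter unseen? (map suc (upTo (suc a)))}
  (∈-filter⁺ unseen? (∈-map⁺ suc (∈-upTo⁺ ℕP.≤-refl)) (>⇒∉shownTo ℕP.≤-refl))
  (AllP.filter⁺ unseen? (AllP.map⁺ (AllP.all-upTo (suc a))))
  z≤n
  where
  unseen? : Decidable (λ c → c ∉ shownTo a)
  unseen? c = _∉?_ ℕ._≟_ c (shownTo a)

-- If n ≥ 2, card n - 1 has just been shown and the descending rule applies; card n is the only one
-- left to name.
guess-last : ∀ a → guess (suc a) (shownTo a) ≡ suc a
guess-last zero    = refl
guess-last (suc a) rewrite dec-true (_∈?_ ℕ._≟_ (suc a) (shownTo (suc a))) (here refl) = largestUnseen-last (suc a)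

correctGuesses-hit : ∀ n shown c deck → guess n shown ≡ c →
                     correctGuesses n shown (c ∷ deck) ≡ suc (correctGuesses n (c ∷ shown) deck)
correctGuesses-hit n shown c deck eq rewrite dec-true (guess n shown ℕ.≟ c) eq = refl

correctGuesses-miss : ∀ n shown c deck → guess n shown ≢ c →
                      correctGuesses n shown (c ∷ deck) ≡ correctGuesses n (c ∷ shown) deck
correctGuesses-miss n shown c deck neq rewrite dec-false (guess n shown ℕ.≟ c) neq = refl

correctGuesses≤length : ∀ n shown deck → correctGuesses n shown deck ℕ.≤ length deck
correctGuesses≤length n shown []         = z≤n
correctGuesses≤length n shown (c ∷ deck) with guess n shown ℕ.≟ c
... | yes eq rewrite correctGuesses-hit n shown c deck eq = s≤s (correctGuesses≤length n (c ∷ shown) deck)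
... | no neq rewrite correctGuesses-miss n shown c deck neq = ℕP.m≤n⇒m≤1+n (correctGuesses≤length n (c ∷ shown) deck)

-- The game resumed after the cards 1, …, a have been drawn in this order.
Xfrom : ∀ a {k} → Vec Place k → ℕ
Xfrom a {k} ω = correctGuesses (a ℕ.+ k) (shownTo a) (shuffle (deckFrom a k) ω)

-- Both places on an empty pile yield the same deck, so this card is guessed in either case.
Xfrom-last : ∀ a d → Xfrom a (d ∷ []) ≡ 1
Xfrom-last a d rewrite ℕP.+-comm a 1 with d
... | top    = correctGuesses-hit (suc a) (shownTo a) (suc a) [] (guess-last a)
... | bottom = correctGuesses-hit (suc a) (shownTo a) (suc a) [] (guess-last a)

module _ (a : ℕ) {k : ℕ} (ω : Vec Place (suc k)) where

  private
    2+a≤ : suc a ℕ.< a ℕ.+ suc (suc k)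
    2+a≤ = subst (suc a ℕ.<_) (sym (trans (ℕP.+-suc a (suc k)) (cong suc (ℕP.+-suc a k)))) (s≤s (s≤s (ℕP.m≤m+n a k)))

  Xfrom-top : Xfrom a (top ∷ ω) ≡ suc (Xfrom (suc a) ω)
  Xfrom-top = trans
    (correctGuesses-hit (a ℕ.+ suc (suc k)) (shownTo a) (suc a) (shuffle (deckFrom (suc a) (suc k)) ω) (guess-next a 2+a≤))
    (cong (λ n → suc (correctGuesses n (shownTo (suc a)) (shuffle (deckFrom (suc a) (suc k)) ω))) (ℕP.+-suc a (suc k)))

  -- Below a nonempty pile, card a + 1 is not the next one shown: the guess a + 1 misses, and the k
  -- + 1 later guesses cannot make up for it.
  Xfrom-bottom : Xfrom a (bottom ∷ ω) ≢ suc (suc k)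
  Xfrom-bottom = miss (shuffle (deckFrom (suc a) (suc k)) ω) (shuffle-deckFrom> (suc a) ω)
                      (length-shuffle (deckFrom (suc a) (suc k)) ω)
    where
    n = a ℕ.+ suc (suc k)
    miss : ∀ pile → All (suc a ℕ.<_) pile → length pile ≡ suc k →
           correctGuesses n (shownTo a) (pile ∷ʳ suc a) ≢ suc (suc k)
    miss (c ∷ pile) (1+a<c ∷ _) len eq = ℕP.1+n≰n (begin
      suc (suc k)                                                   ≡⟨ eq ⟨
      correctGuesses n (shownTo a) (c ∷ pile ∷ʳ suc a)              ≡⟨ correctGuesses-miss n (shownTo a) c (pile ∷ʳ suc a)
                                                                         (λ g≡c → ℕP.<⇒≢ 1+a<c (trans (sym (guess-next a 2+a≤)) g≡c)) ⟩
      correctGuesses n (c ∷ shownTo a) (pile ∷ʳ suc a)              ≤⟨ correctGuesses≤length n (c ∷ shownTo a) (pile ∷ʳ suc a) ⟩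
      length (pile ∷ʳ suc a)                                        ≡⟨ trans (length-++ pile) (ℕP.+-comm (length pile) 1) ⟩
      suc (length pile)                                             ≡⟨ len ⟩
      suc k                                                         ∎)
      where open ℕP.≤-Reasoning

Perfect? : ∀ a {k} → Decidable (λ (ω : Vec Place k) → Xfrom a ω ≡ k)
Perfect? a {k} ω = Xfrom a ω ℕ.≟ k

filter-map : ∀ {A B : Set} {P : Pred A 0ℓ} {Q : Pred B 0ℓ} (P? : Decidable P) (Q? : Decidable Q) (f : A → B) →
             (∀ x → P x → Q (f x)) → (∀ x → Q (f x) → P x) → ∀ xs → filter Q? (map f xs) ≡ map f (filter P? xs)
filter-map P? Q? f to from []       = refl
filter-map P? Q? f to from (x ∷ xs) with P? x
... | yes Px rewrite dec-true  (Q? (f x)) (to x Px)    = cong (f x ∷_) (filter-map P? Q? f to from xs)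
... | no ¬Px rewrite dec-false (Q? (f x)) (¬Px ∘ from x) = filter-map P? Q? f to from xs

perfect-outcomes : ∀ a k → filter (Perfect? a) (outcomes (suc (suc k))) ≡
                           map (top ∷_) (filter (Perfect? (suc a)) (outcomes (suc k)))
perfect-outcomes a k = begin
  filter (Perfect? a) (map (top ∷_) os ++ map (bottom ∷_) os)
    ≡⟨ filter-++ (Perfect? a) (map (top ∷_) os) (map (bottom ∷_) os) ⟩
  filter (Perfect? a) (map (top ∷_) os) ++ filter (Perfect? a) (map (bottom ∷_) os)
    ≡⟨ cong₂ _++_ (filter-map (Perfect? (suc a)) (Perfect? a) (top ∷_)
                     (λ ω eq → trans (Xfrom-top a ω) (cong suc eq))
                     (λ ω eq → ℕP.suc-injective (trans (sym (Xfrom-top a ω)) eq)) os)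
                  (filter-none (Perfect? a) (AllP.map⁺ (All.universal (Xfrom-bottom a) os))) ⟩
  map (top ∷_) (filter (Perfect? (suc a)) os) ++ []
    ≡⟨ ++-identityʳ _ ⟩
  map (top ∷_) (filter (Perfect? (suc a)) os) ∎
  where
  open ≡-Reasoning
  os = outcomes (suc k)

totalWeight : ∀ {k} → ℝ → List (Vec Place k) → ℝ
totalWeight p = foldr (λ ω s → weight p ω +ℝ s) 0ℝ

module _ (p : ℝ) (m : ℕ) where

  totalWeight-top : ∀ {k} (ωs : List (Vec Place k)) →
                    seq (totalWeight p (map (top ∷_) ωs)) m ≡ seq p m * seq (totalWeight p ωs) m
  totalWeight-top []       = sym (*-zeroʳ (seq p m))
  totalWeight-top (ω ∷ ωs) = trans (cong (seq p m * seq (weight p ω) m +_) (totalWeight-top ωs))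
    (sym (*-distribˡ-+ (seq p m) (seq (weight p ω) m) (seq (totalWeight p ωs) m)))

  totalWeight-single : seq (totalWeight p (outcomes (suc zero))) m ≡ 1ℚ
  totalWeight-single = lem (seq p m)
    where
    lem : ∀ q → q * 1ℚ + ((1ℚ + - q) * 1ℚ + 0ℚ) ≡ 1ℚ
    lem = solve-∀ ℚ-ring

  totalWeight-last : ∀ a → seq (totalWeight p (filter (Perfect? a) (outcomes (suc zero)))) m ≡ seq (totalWeight p (outcomes (suc zero))) m
  totalWeight-last a = cong (λ ωs → seq (totalWeight p ωs) m)
    (filter-all (Perfect? a) {outcomes (suc zero)} (Xfrom-last a top ∷ Xfrom-last a bottom ∷ []))

  -- An exact equality of rationals at every index m. Each card but the last contributes p, the last
  -- one p + (1 - p) = 1.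
  totalWeight-perfect : ∀ a k → seq (totalWeight p (filter (Perfect? a) (outcomes (suc k)))) m ≡ pow (seq p m) k
  totalWeight-perfect a zero = trans (totalWeight-last a) totalWeight-single
  totalWeight-perfect a (suc k) = begin
    seq (totalWeight p (filter (Perfect? a) (outcomes (suc (suc k))))) m
      ≡⟨ cong (λ ωs → seq (totalWeight p ωs) m) (perfect-outcomes a k) ⟩
    seq (totalWeight p (map (top ∷_) (filter (Perfect? (suc a)) (outcomes (suc k))))) m
      ≡⟨ totalWeight-top (filter (Perfect? (suc a)) (outcomes (suc k))) ⟩
    seq p m * seq (totalWeight p (filter (Perfect? (suc a)) (outcomes (suc k)))) m
      ≡⟨ cong (seq p m *_) (totalWeight-perfect (suc a) k) ⟩
    seq p m * pow (seq p m) k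
      ≡⟨ *-comm (seq p m) (pow (seq p m) k) ⟩
    pow (seq p m) k * seq p m ∎
    where open ≡-Reasoning

  ℙ-perfect : ∀ k → seq (ℙ p (λ (ω : Vec Place (suc k)) → X (suc k) ω ℕ.≟ suc k)) m ≡ pow (seq p m) k
  ℙ-perfect k = trans
    (cong (λ (deck : Vec ℕ (suc k)) → seq (ℙ p (λ (ω : Vec Place (suc k)) → correctGuesses (suc k) [] (shuffle deck ω) ℕ.≟ suc k)) m)
          (tabulate≡deckFrom 0 (suc ∘ toℕ) (λ _ → refl)))
    (totalWeight-perfect 0 k)

-- Limits of real sequences from their rational approximations

⟶-from-rational : ∀ {a : ℕ → ℝ} {L : ℝ} →
  (∀ {ε} → 0ℚ < ε → Eventually (λ n → Eventually (λ m → ∣ seq (a n) m - seq L m ∣ ≤ ε))) → a ⟶ L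
⟶-from-rational {a} {L} h ε (ε₀ , 0<ε₀ , N , ε₀≤ε) =
  -- Half of `ε₀` bounds the distance, the other half is the gap that `_<ℝ_` requires.
  map-ev {Q = λ n → ∣ a n -ℝ L ∣ℝ <ℝ ε} (λ n close → ε₀ * ½ , 0<ε½ 0<ε₀ , map-ev (λ m → bound n m) (close ,ᵉ (N , ε₀≤ε))) (h (0<ε½ 0<ε₀))
  where
  open ≤-Reasoning
  bound : ∀ n m → ∣ seq (a n) m - seq L m ∣ ≤ ε₀ * ½ × 0ℚ + ε₀ ≤ seq ε m → ∣ seq (a n) m - seq L m ∣ + ε₀ * ½ ≤ seq ε m
  bound n m (d≤ , ε₀≤) = begin
    ∣ seq (a n) m - seq L m ∣ + ε₀ * ½  ≤⟨ +-monoˡ-≤ (ε₀ * ½) d≤ ⟩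
    ε₀ * ½ + ε₀ * ½                     ≡⟨ trans (halves ε₀) (sym (+-identityˡ ε₀)) ⟩
    0ℚ + ε₀                             ≤⟨ ε₀≤ ⟩
    seq ε m                             ∎

recip-eventually : ∀ {D} → 0ℚ ≤ D → ∀ {ε} → 0ℚ < ε → Eventually (λ r → D * recip r ≤ ε)
recip-eventually {D} 0≤D 0<ε =
  let η , _ , Dη≤ε = shrink 0<ε D
      j , rj≤η = recip-small {η} (proj₁ (proj₂ (shrink 0<ε D)))
  in j , λ r r≥j → ≤-trans (*-monoˡ-≤-nonNeg D {{nonNegative 0≤D}} (≤-trans (recip-anti r≥j) rj≤η)) Dη≤ε

-- The three ranges of α

module PerfectGame
  (α λ₀ : ℝ) (0<α : 0ℝ <ℝ α) (0<λ₀ : 0ℝ <ℝ λ₀)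
  (p : ℕ → ℝ) (p≈ : ∃[ n₀ ] (∀ n → n ≥ n₀ → p n ≈ 1ℝ -ℝ λ₀ *ℝ n ^ℝ (-ℝ α)))
  where

  private
    a l : ℕ → ℚ
    a = seq α
    l = seq λ₀

    A Λ a₀ l₀ : ℚ
    A  = proj₁ (bounded {a} (cauchy α))
    Λ  = proj₁ (bounded {l} (cauchy λ₀))
    a₀ = proj₁ 0<α
    l₀ = proj₁ 0<λ₀

    0<Λ : 0ℚ < Λ
    0<Λ = proj₁ (proj₂ (bounded {l} (cauchy λ₀)))

    0≤A : 0ℚ ≤ A
    0≤A = <⇒≤ (proj₁ (proj₂ (bounded {a} (cauchy α))))

    0<a₀ : 0ℚ < a₀
    0<a₀ = proj₁ (proj₂ 0<α)

    0<l₀ : 0ℚ < l₀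
    0<l₀ = proj₁ (proj₂ 0<λ₀)

    a₀≤a : Eventually (λ m → a₀ ≤ a m)
    a₀≤a = map-ev (λ m → subst (_≤ a m) (+-identityˡ a₀)) (proj₂ (proj₂ 0<α))

    l-bounded : Eventually (λ m → l₀ ≤ l m × l m ≤ Λ)
    l-bounded = map-ev (λ m → λ { (h , g) → subst (_≤ l m) (+-identityˡ l₀) h , ≤-trans (p≤∣p∣ (l m)) g })
      (proj₂ (proj₂ 0<λ₀) ,ᵉ proj₂ (proj₂ (bounded {l} (cauchy λ₀))))

    a-bounded : Eventually (λ m → 0ℚ ≤ a m × a m ≤ A)
    a-bounded = map-ev (λ m → λ { (h , g) → ≤-trans (<⇒≤ 0<a₀) h , ≤-trans (p≤∣p∣ (a m)) g })
      (a₀≤a ,ᵉ proj₂ (proj₂ (bounded {a} (cauchy α))))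

    -- the m-th approximation of λ n^(-α) = 1 - pₙ
    x : ℕ → ℕ → ℚ
    x n m = l m * power a n m

    p≈1-x : Eventually (λ n → ∀ {ε} → 0ℚ < ε → Eventually (λ m → ∣ seq (p n) m - (1ℚ - x n m) ∣ ≤ ε))
    p≈1-x = map-ev (λ n pn≈ {ε} 0<ε → map-ev (λ m → bound n m) (pn≈ ε 0<ε)) p≈
      where
      bound : ∀ n m {ε} → ∣ seq (p n) m - (1ℚ - l m * expSum (- a m * lnSum n m) m) ∣ < ε →
              ∣ seq (p n) m - (1ℚ - x n m) ∣ ≤ ε
      -- Unfolding `n ^ℝ (-ℝ α)` negates the factor `a m`, whereas `power` negates the whole
      -- product.
      bound n m {ε} h = <⇒≤ (subst (λ z → ∣ seq (p n) m - (1ℚ - l m * expSum z m) ∣ < ε)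
        (sym (neg-distribˡ-* (a m) (lnSum n m))) h)

    -- As n^(-α) tends to 0, pₙ is a probability for large n already at the level of approximations;
    -- the inequalities on powers need this.
    x-range : Eventually (λ n → Eventually (λ m → 0ℚ ≤ x n m × x n m ≤ 1ℚ))
    x-range =
      let η , 0<η , Λη≤1 = shrink (positive⁻¹ 1ℚ) Λ
      in shift-ev (map-ev (λ n small → map-ev (λ m → bound n m Λη≤1) (small ,ᵉ regular a 0≤A a-bounded n ,ᵉ l-bounded))
           (unshift-ev (power-small a 0≤A a-bounded 0<a₀ a₀≤a 0<η)))
      where
      bound : ∀ n m {η} → Λ * η ≤ 1ℚ → power a (suc n) m ≤ η × Regular a (suc n) m × l₀ ≤ l m × l m ≤ Λ →
              0ℚ ≤ x (suc n) m × x (suc n) m ≤ 1ℚ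
      bound n m Λη≤1 (e≤η , reg , l₀≤l , l≤Λ) =
        0≤* (≤-trans (<⇒≤ 0<l₀) l₀≤l) 0≤power ,
        ≤-trans (*-mono-≤₀ (<⇒≤ 0<Λ) 0≤power l≤Λ e≤η) Λη≤1
        where open Regular reg

  probability : ℕ → ℝ
  probability n = ℙ (p n) (λ ω → X n ω ≟ n)

  -- Replaces pₙ, which agrees with 1 - λ n^(-α) only in the limit over m, by the approximations of
  -- the latter.
  probability-⟶ : ∀ {L} →
    (∀ {ε} → 0ℚ < ε → Eventually (λ r → Eventually (λ m →
       0ℚ ≤ x (suc r) m → x (suc r) m ≤ 1ℚ → ∣ pow (1ℚ - x (suc r) m) r - seq L m ∣ ≤ ε))) →
    probability ⟶ L
  probability-⟶ {L} h = ⟶-from-rational {probability} {L} λ {ε} 0<ε →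
    shift-ev (map-ev (λ r → close r 0<ε) (unshift-ev (p≈1-x ,ᵉ x-range) ,ᵉ h (0<ε½ 0<ε)))
    where
    close : ∀ r {ε} → 0ℚ < ε →
      ((∀ {ε} → 0ℚ < ε → Eventually (λ m → ∣ seq (p (suc r)) m - (1ℚ - x (suc r) m) ∣ ≤ ε)) ×
        Eventually (λ m → 0ℚ ≤ x (suc r) m × x (suc r) m ≤ 1ℚ)) ×
      Eventually (λ m → 0ℚ ≤ x (suc r) m → x (suc r) m ≤ 1ℚ → ∣ pow (1ℚ - x (suc r) m) r - seq L m ∣ ≤ ε * ½) →
      Eventually (λ m → ∣ seq (probability (suc r)) m - seq L m ∣ ≤ ε)
    close r {ε} 0<ε ((p≈ , range) , pow≈) =
      let C , 0≤C , lip = pow-lipschitz′ r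
          η , 0<η , Cη≤ = shrink (0<ε½ 0<ε) C
      -- Closeness is requested twice: within η to make the error small, and within 1 so that the
      -- Lipschitz bound applies.
      in map-ev (λ m → bound C 0≤C lip Cη≤ m) (p≈ 0<η ,ᵉ p≈ (positive⁻¹ 1ℚ) ,ᵉ range ,ᵉ pow≈)
      where
      open ≤-Reasoning
      bound : ∀ C → 0ℚ ≤ C →
              (∀ {a b} → 0ℚ ≤ b → b ≤ 1ℚ → ∣ a - b ∣ ≤ 1ℚ → ∣ pow a r - pow b r ∣ ≤ C * ∣ a - b ∣) →
              ∀ {η} → C * η ≤ ε * ½ → ∀ m →
              ∣ seq (p (suc r)) m - (1ℚ - x (suc r) m) ∣ ≤ η ×
              ∣ seq (p (suc r)) m - (1ℚ - x (suc r) m) ∣ ≤ 1ℚ ×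
              (0ℚ ≤ x (suc r) m × x (suc r) m ≤ 1ℚ) ×
              (0ℚ ≤ x (suc r) m → x (suc r) m ≤ 1ℚ → ∣ pow (1ℚ - x (suc r) m) r - seq L m ∣ ≤ ε * ½) →
              ∣ seq (probability (suc r)) m - seq L m ∣ ≤ ε
      bound C 0≤C lip {η} Cη≤ m (q≈ , q≈₁ , (0≤x , x≤1) , pow≈) = begin
        ∣ seq (probability (suc r)) m - seq L m ∣
          ≡⟨ cong (λ z → ∣ z - seq L m ∣) (ℙ-perfect (p (suc r)) m r) ⟩
        ∣ pow q r - seq L m ∣
          ≤⟨ ∣-∣-triangle (pow q r) (pow y r) (seq L m) ⟩
        ∣ pow q r - pow y r ∣ + ∣ pow y r - seq L m ∣
          ≤⟨ +-mono-≤ (begin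
               ∣ pow q r - pow y r ∣  ≤⟨ lip (0≤sub x≤1) (≤-cert (x (suc r) m) 0≤x (sym (sub-add 1ℚ (x (suc r) m)))) q≈₁ ⟩
               C * ∣ q - y ∣          ≤⟨ *-monoˡ-≤-nonNeg C {{nonNegative 0≤C}} q≈ ⟩
               C * η                  ≤⟨ Cη≤ ⟩
               ε * ½                  ∎)
             (pow≈ 0≤x x≤1) ⟩
        ε * ½ + ε * ½
          ≡⟨ halves ε ⟩
        ε ∎
        where
        q = seq (p (suc r)) m
        y = 1ℚ - x (suc r) m

  α<1⇒⟶0 : α <ℝ 1ℝ → probability ⟶ 0ℝ
  α<1⇒⟶0 (δ , 0<δ , α+δ≤1) = probability-⟶ {0ℝ} λ {ε} 0<ε →
    let c , h = exceed (0<* 0<ε 0<l₀) 1ℚ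
    in map-ev (λ r large → map-ev (λ m → bound r m 0<ε c (h c ℕP.≤-refl)) (large ,ᵉ l-bounded))
         (unshift-ev (n*power-large a 0≤A a-bounded 0<δ α+δ≤1 (ι c)))
    where
    bound : ∀ r m {ε} → 0ℚ < ε → ∀ c → 1ℚ ≤ ε * l₀ * ι c →
            ι c ≤ ι (suc r) * power a (suc r) m × l₀ ≤ l m × l m ≤ Λ →
            0ℚ ≤ x (suc r) m → x (suc r) m ≤ 1ℚ → ∣ pow (1ℚ - x (suc r) m) r - 0ℚ ∣ ≤ ε
    bound r m {ε} 0<ε c 1≤ (c≤ , l₀≤l , _) 0≤x x≤1 = begin
      ∣ pow (1ℚ - x (suc r) m) r - 0ℚ ∣  ≡⟨ trans (cong ∣_∣ (+-identityʳ (pow (1ℚ - x (suc r) m) r))) (0≤p⇒∣p∣≡p 0≤pow) ⟩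
      pow (1ℚ - x (suc r) m) r           ≤⟨ ≤-by-product (positive⁻¹ 1ℚ) 0≤pow (<⇒≤ 0<ε) (pow*[1+nx]≤1 0≤x x≤1 r) (begin
        1ℚ                                 ≤⟨ 1≤ ⟩
        ε * l₀ * ι c                       ≡⟨ *-assoc ε l₀ (ι c) ⟩
        ε * (l₀ * ι c)                     ≤⟨ *-monoˡ-≤-nonNeg ε {{nonNegative (<⇒≤ 0<ε)}} (begin
          l₀ * ι c                           ≤⟨ *-mono-≤₀ (≤-trans (<⇒≤ 0<l₀) l₀≤l) (0≤ι c) l₀≤l c≤ ⟩
          l m * (ι (suc r) * e)              ≡⟨ cong (λ z → l m * (z * e)) (ι-suc r) ⟩
          -- The passage from n = r + 1 to r costs one x, which is at most 1.
          l m * ((ι r + 1ℚ) * e)             ≤⟨ ≤-cert (1ℚ - l m * e) (0≤sub x≤1) (lem (l m) (ι r) e) ⟩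
          1ℚ + ι r * x (suc r) m             ∎) ⟩
        ε * (1ℚ + ι r * x (suc r) m)       ∎) ⟩
      ε                                  ∎
      where
      open ≤-Reasoning
      e = power a (suc r) m
      0≤pow = pow-nonneg (0≤sub x≤1) r
      lem : ∀ l r e → 1ℚ + r * (l * e) ≡ l * ((r + 1ℚ) * e) + (1ℚ - l * e)
      lem = solve-∀ ℚ-ring

  α≈1⇒⟶exp : α ≈ 1ℝ → probability ⟶ exp (-ℝ λ₀)
  α≈1⇒⟶exp α≈1 = probability-⟶ {exp (-ℝ λ₀)} λ {ε} 0<ε →
    -- A quarter of ε goes to nx ≈ λ, a quarter to e⁻ʸ eʸ ≈ 1, and a half to the terms of order 1/n.
    let q = ε * ½ * ½
        0<q = 0<ε½ (0<ε½ 0<ε)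
        η , 0<η , Λη≤ = shrink 0<q Λ
        c , Λ≤c = archimedean Λ
    in shift-ev (map-ev (λ r′ h →
         map-ev (λ m → bound r′ m Λη≤ (proj₁ h) (≤-trans Λ≤c (ι-mono (ℕP.m≤n⇒m≤1+n (ℕP.m≤n⇒m≤1+n (proj₂ h))))))
           (n*power≈1 a 0≤A a-bounded a≈1 r′ 0<η ,ᵉ l-bounded
            -- The last condition says m ≥ n + 1, the length of the series that dominates n factors
            -- 1 + λ/n.
            ,ᵉ expSum-neg-small (<⇒≤ 0<Λ) 0<q ,ᵉ (suc (suc (suc r′)) , λ _ → λ m≥ → m≥)))
         (unshift-ev (recip-eventually (0≤+ (<⇒≤ 0<Λ) (0≤* (<⇒≤ 0<Λ) (<⇒≤ 0<Λ))) (0<ε½ 0<ε)) ,ᵉ (c , λ _ r≥c → r≥c)))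
    where
    open ≤-Reasoning
    a≈1 : ∀ {η} → 0ℚ < η → Eventually (λ m → ∣ a m - 1ℚ ∣ ≤ η)
    a≈1 {η} 0<η = map-ev (λ _ → <⇒≤) (α≈1 η 0<η)
    bound : ∀ r′ m {η ε} → Λ * η ≤ ε * ½ * ½ → (Λ + Λ * Λ) * recip (suc r′) ≤ ε * ½ → Λ ≤ ι (suc (suc r′)) →
            ∣ ι (suc (suc r′)) * power a (suc (suc r′)) m - 1ℚ ∣ ≤ η × (l₀ ≤ l m × l m ≤ Λ) ×
            (∀ {y} → 0ℚ ≤ y → y ≤ Λ → ∣ expSum (- y) m * expSum y m - 1ℚ ∣ ≤ ε * ½ * ½) × suc (suc (suc r′)) ℕ.≤ m →
            0ℚ ≤ x (suc (suc r′)) m → x (suc (suc r′)) m ≤ 1ℚ →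
            ∣ pow (1ℚ - x (suc (suc r′)) m) (suc r′) - expSum (- l m) m ∣ ≤ ε
    bound r′ m {η} {ε} Λη≤ Λr≤ Λ≤n (ne≈1 , (l₀≤l , l≤Λ) , inv , n<m) 0≤x x≤1 = begin
      ∣ pow (1ℚ - x n m) (suc r′) - expSum (- l m) m ∣
        ≤⟨ pow-expSum-limit (suc r′) 0≤x x≤1 0≤l l≤Λ Λ≤n nx≈l n<m (inv 0≤l l≤Λ) ⟩
      ε * ½ * ½ + ε * ½ * ½ + (Λ + Λ * Λ) * recip (suc r′)
        ≤⟨ +-mono-≤ (≤-reflexive (halves (ε * ½))) Λr≤ ⟩
      ε * ½ + ε * ½
        ≡⟨ halves ε ⟩
      ε ∎
      where
      n = suc (suc r′)
      e = power a n m
      0≤l = ≤-trans (<⇒≤ 0<l₀) l₀≤l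
      lem : ∀ n l e → n * (l * e) - l ≡ l * (n * e - 1ℚ)
      lem = solve-∀ ℚ-ring
      nx≈l : ∣ ι n * x n m - l m ∣ ≤ ε * ½ * ½
      nx≈l = begin
        ∣ ι n * (l m * e) - l m ∣      ≡⟨ cong ∣_∣ (lem (ι n) (l m) e) ⟩
        ∣ l m * (ι n * e - 1ℚ) ∣       ≡⟨ trans (∣p*q∣≡∣p∣*∣q∣ (l m) (ι n * e - 1ℚ)) (cong (_* ∣ ι n * e - 1ℚ ∣) (0≤p⇒∣p∣≡p 0≤l)) ⟩
        l m * ∣ ι n * e - 1ℚ ∣         ≤⟨ *-mono-≤₀ (<⇒≤ 0<Λ) (0≤∣p∣ (ι n * e - 1ℚ)) l≤Λ ne≈1 ⟩
        Λ * η                          ≤⟨ Λη≤ ⟩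
        ε * ½ * ½                      ∎

  1<α⇒⟶1 : 1ℝ <ℝ α → probability ⟶ 1ℝ
  1<α⇒⟶1 (δ , 0<δ , 1+δ≤α) = probability-⟶ {1ℝ} λ {ε} 0<ε →
    let η , 0<η , Λη≤ε = shrink 0<ε Λ
    in map-ev (λ r small → map-ev (λ m → bound r m Λη≤ε) (small ,ᵉ l-bounded ,ᵉ regular a 0≤A a-bounded r))
         (unshift-ev (n*power-small a 0≤A a-bounded 0<δ 1+δ≤α 0<η))
    where
    bound : ∀ r m {η ε} → Λ * η ≤ ε →
            ι (suc r) * power a (suc r) m ≤ η × (l₀ ≤ l m × l m ≤ Λ) × Regular a (suc r) m →
            0ℚ ≤ x (suc r) m → x (suc r) m ≤ 1ℚ → ∣ pow (1ℚ - x (suc r) m) r - 1ℚ ∣ ≤ ε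
    bound r m {η} {ε} Λη≤ε (ne≤η , (_ , l≤Λ) , reg) 0≤x x≤1 = begin
      ∣ pow (1ℚ - x n m) r - 1ℚ ∣    ≡⟨ ∣-∣-sym (pow (1ℚ - x n m) r) 1ℚ ⟩
      ∣ 1ℚ - pow (1ℚ - x n m) r ∣    ≡⟨ 0≤p⇒∣p∣≡p (0≤sub (pow≤1 (0≤sub x≤1) (≤-cert (x n m) 0≤x (sym (sub-add 1ℚ (x n m)))) r)) ⟩
      1ℚ - pow (1ℚ - x n m) r        ≤⟨ +-monoʳ-≤ 1ℚ (neg-antimono-≤ (bernoulli 0≤x x≤1 r)) ⟩
      1ℚ - (1ℚ - ι r * (l m * e))    ≡⟨ lem (ι r) (l m) e ⟩
      l m * (ι r * e)                ≤⟨ *-mono-≤₀ (<⇒≤ 0<Λ) (0≤* (0≤ι r) 0≤power) l≤Λ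
                                          (≤-trans (*-monoʳ-≤-nonNeg e {{nonNegative 0≤power}} (ι-mono (ℕP.n≤1+n r))) ne≤η) ⟩
      Λ * η                          ≤⟨ Λη≤ε ⟩
      ε                              ∎
      where
      open ≤-Reasoning
      open Regular reg
      n = suc r
      e = power a n m
      lem : ∀ r l e → 1ℚ - (1ℚ - r * (l * e)) ≡ l * (r * e)
      lem = solve-∀ ℚ-ring

mainTheorem10 : (α λ₀ : ℝ) → 0ℝ <ℝ α → 0ℝ <ℝ λ₀ →
    (p : ℕ → ℝ) →
    (∃[ n₀ ] (∀ n → n ≥ n₀ → p n ≈ 1ℝ -ℝ λ₀ *ℝ n ^ℝ (-ℝ α))) →
    (α <ℝ 1ℝ → (λ n → ℙ (p n) (λ ω → X n ω ≟ n)) ⟶ 0ℝ) ×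
    (α ≈ 1ℝ → (λ n → ℙ (p n) (λ ω → X n ω ≟ n)) ⟶ exp (-ℝ λ₀)) ×
    (1ℝ <ℝ α → (λ n → ℙ (p n) (λ ω → X n ω ≟ n)) ⟶ 1ℝ)
mainTheorem10 α λ₀ 0<α 0<λ₀ p p≈ = α<1⇒⟶0 , α≈1⇒⟶exp , 1<α⇒⟶1
  where open PerfectGame α λ₀ 0<α 0<λ₀ p p≈
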